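{- The control-state reachability problem for senescent rbGTRS is undecidable. That is, there is no algorithm that, given a senescent rbGTRS $G=(\mathcal P,\Sigma,\Gamma,\mathcal R,\mathcal C,r)$ with a lifespan $\ell\in\mathbb N$, control-states $p_1,p_2\in\mathcal P$ and a tree $t_1$ over $\Sigma$, decides whether there exist a tree $t_2$ over $\Sigma$ and a counter valuation $\nu_2$ such that $G$ has a lifespan-restricted run with lifespan $\ell$ from $(p_1,t_1,\nu_0)$ to $(p_2,t_2,\nu_2)$, where $\nu_0$ is the valuation assigning $0$ to every counter.
   Context: **Trees.** A ranked alphabet is a finite set $\Sigma$ with a rank function $\rho:\Sigma\to\mathbb N$. A tree over $\Sigma$ is a pair $t=(D,\lambda)$, where the domain $D\subset\mathbb N^*$ is a non-empty finite set of nodes that is prefix-closed and younger-sibling-closed (if $\eta i\in D$ then $\eta\in D$ and $\eta j\in D$ for all $1\le j\le i$; children are numbered from 1), and $\lambda:D\to\Sigma$ is such that a node labelled $a$ has exactly $\rho(a)$ children. A context $C=C[x]$ (with one variable) is a tree over $\Sigma\uplus\{x\}$, where $x$ has rank $0$ and labels exactly one node; $C[t]$ is the tree obtained by replacing that node by $t$. An NTA over $\Sigma$ is a bottom-up non-deterministic finite tree automaton over $\Sigma$; $\mathcal L(\mathcal T)$ is the set of trees accepted by the NTA $\mathcal T$. **Counters.** Let $\mathcal C$ be a finite set of counter variables. An atomic counter constraint is an expression $c\sim v$ with $c\in\mathcal C$, $v\in\mathbb Z$, $\sim\,\in\{<,\le,=,\ge,>\}$; a counter constraint is a boolean combination of these,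 and $\mathrm{Cons}_{\mathcal C}$ is the set of counter constraints. A counter valuation is a map $\nu:\mathcal C\to\mathbb Z$; $\theta[\nu]$ is the truth value of the constraint $\theta$ under $\nu$; valuations are added pointwise. A sequence $\nu_1,\dots,\nu_n$ of valuations is $r$-reversal-bounded for $c\in\mathcal C$ if it can be partitioned into $r+1$ consecutive (contiguous) subsequences $A_1,\dots,A_{r+1}$, with $\nu_1,\dots,\nu_n=A_1,\dots,A_{r+1}$, such that for each $1\le i\le r+1$ there is $\sim\,\in\{\le,\ge\}$ with $\nu_j(c)\sim\nu_{j+1}(c)$ for all $\nu_j,\nu_{j+1}$ appearing together in $A_i$. **rbGTRS.** A state-extended ground tree rewrite system with $r$-reversal-bounded counters (rbGTRS) is a tuple $G=(\mathcal P,\Sigma,\Gamma,\mathcal R,\mathcal C,r)$, where $\mathcal P$ is a finite set of control-states, $\Sigma$ a finite ranked alphabet, $\Gamma$ a finite alphabet of output symbols, $\mathcal C$ a finite set of counters, $r\in\mathbb N$, and $\mathcal R$ a finite set of rules $(p,\mathcal T,\theta)\xrightarrow{\gamma}(p',\mathcal T',\mu)$ with $p,p'\in\mathcal P$, $\gamma\in\Gamma$, $\theta\in\mathrm{Cons}_{\mathcal C}$, $\mu:\mathcal C\to\mathbb Z$, and $\mathcal T,\mathcal T'$ NTAs over $\Sigma$. A configuration is a triple $(p,t,\nu)$ of a control-state, a tree over $\Sigma$ and a counter valuation. There is a transition $(p,t,\nu)\xrightarrow{\gamma}(p',t',\nu')$ iff there is a rule $(p,\mathcal T,\theta)\xrightarrow{\gamma}(p',\mathcal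 T',\mu)$ in $\mathcal R$ such that $\theta[\nu]$ is true, $\nu'=\nu+\mu$, and $t=C[s]$, $t'=C[s']$ for some context $C$ and trees $s\in\mathcal L(\mathcal T)$, $s'\in\mathcal L(\mathcal T')$. A run is a finite sequence of configurations $(p_1,t_1,\nu_1),\dots,(p_n,t_n,\nu_n)$, consecutive ones related by transitions, such that $\nu_1,\dots,\nu_n$ is $r$-reversal-bounded for every $c\in\mathcal C$. **Ages and senescence.** Consider a run $(p_1,t_1,\nu_1),\dots,(p_n,t_n,\nu_n)$ together with the contexts $C_1,\dots,C_{n-1}$ and trees used by its transitions: for $1\le i<n$, $t_i=C_i[t^{\mathrm{out}}_i]$ and $t_{i+1}=C_i[t^{\mathrm{in}}_{i+1}]$, where the rule used has left NTA accepting $t^{\mathrm{out}}_i$ and right NTA accepting $t^{\mathrm{in}}_{i+1}$. For a node $\eta$ in the domain of $t_i$, its birthdate (at position $i$) is the largest $j$ with $2\le j\le i$ such that $\eta$ is in the domain of $t_j=C_{j-1}[t^{\mathrm{in}}_j]$ and $\eta$ is in the domain of $C_{j-1}[x]$ only if its label there is $x$ (i.e. $\eta$ lies in the newly written subtree $t^{\mathrm{in}}_j$); if there is no such $j$, its birthdate is $1$. If $j$ is the birthdate of $\eta$ at position $i$, the age of $\eta$ at position $i$ is the cardinality of $\{i' : j\le i'<i,\ p_{i'}\ne p_{i'+1}\}$, i.e. the number of control-state changes between the $j$th and $i$th configurations. The run is lifespan-restricted with lifespan $\ell$ if in each transition from position $i$ to $i+1$ all nodes of the rewritten subtree $t^{\mathrm{out}}_i$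 (i.e. all nodes $\eta$ of $C_i[t^{\mathrm{out}}_i]$ that are in the domain of $C_i[x]$ only if labelled $x$ there) have age at most $\ell$ at position $i$. A senescent rbGTRS with lifespan $\ell$ is an rbGTRS whose runs are required to be lifespan-restricted with lifespan $\ell$. Its underlying control-state graph is otherwise unrestricted (arbitrary cycles are allowed). -}

module Defs where

open import Data.Bool.Base using (Bool; true; false)
open import Data.Empty using (⊥)
open import Data.Fin.Base as Fin using (Fin; zero; suc; toℕ; inject₁; fromℕ)
import Data.Fin.Properties as Fin
open import Data.Fin.Subset using (Subset)
  renaming (_∈_ to _∈ˢ_)
open import Data.Integer.Base as ℤ using (ℤ; +_; -[1+_]; 0ℤ)
open import Data.List.Base as List using (List; []; _∷_)
open import Data.List.Membership.Propositional using (_∈_)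
open import Data.List.Relation.Unary.Linked using (Linked)
open import Data.Maybe.Base using (Maybe; just; nothing; maybe′)
open import Data.Nat.Base using (ℕ; zero; suc; _+_; _*_; _^_; _≤_)
open import Data.Nat.Properties
  using (suc-injective; *-identityˡ; *-assoc; *-cancelˡ-≡; even≢odd)
open import Data.Product
  using (∃; ∃₂; ∃-syntax; Σ-syntax; ∃!; _×_; _,_; proj₁; proj₂)
open import Data.Sum.Base using (_⊎_)
open import Data.Unit.Base using (⊤)
open import Data.Vec.Base as Vec using (Vec; []; _∷_; lookup; replicate; zipWith; _[_]≔_)
open import Data.Vec.Relation.Binary.Pointwise.Inductive using (Pointwise)
import Data.Vec.Relation.Unary.All as Vec
open import Function.Base using (_∘_; id)
open import Function.Bundles using (_↣_; mk↣; Injection)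
open import Relation.Binary.Construct.Closure.ReflexiveTransitive using (Star)
open import Relation.Binary.PropositionalEquality
  using (_≡_; _≢_; refl; sym; trans; cong; cong₂)
open import Relation.Nullary using (¬_; ¬?; _×-dec_; Reflects; contradiction)

------------------------------------------------------------------------
-- Trees

record RankedAlphabet : Set where
  field
    size  : ℕ
    ranks : Vec ℕ size

  Symbol : Set
  Symbol = Fin size

  rank : Symbol → ℕ
  rank = lookup ranks

data Tree {A : Set} (ρ : A → ℕ) : Set where
  node : (a : A) → Vec (Tree ρ) (ρ a) → Tree ρ

Node : Set
Node = List ℕ

-- Labelled t η a: the node η is in the domain of t and has label a.
-- Children are numbered from 1.

data Labelled {A : Set} {ρ : A → ℕ} : Tree ρ → Node → A → Set where
  root  : ∀ {a ts} → Labelled (node a ts) [] a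
  child : ∀ {a ts η b} (i : Fin (ρ a)) →
          Labelled (lookup ts i) η b →
          Labelled (node a ts) (suc (toℕ i) ∷ η) b

Dom : {A : Set} {ρ : A → ℕ} → Tree ρ → Node → Set
Dom t η = ∃ λ a → Labelled t η a

-- The variable x is represented by the additional symbol `nothing`.

withVar : {A : Set} → (A → ℕ) → Maybe A → ℕ
withVar ρ = maybe′ ρ 0

record Context {A : Set} (ρ : A → ℕ) : Set where
  field
    tree      : Tree (withVar ρ)
    uniqueVar : ∃! _≡_ λ η → Labelled tree η nothing

module _ {A : Set} {ρ : A → ℕ} where

  mutual
    substitute : Tree (withVar ρ) → Tree ρ → Tree ρ
    substitute (node (just a) ts) s = node a (substitutes ts s)
    substitute (node nothing  []) s = s

    substitutes : ∀ {n} → Vec (Tree (withVar ρ)) n → Tree ρ → Vec (Tree ρ) n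
    substitutes []       s = []
    substitutes (t ∷ ts) s = substitute t s ∷ substitutes ts s

  infix 8 _⟦_⟧
  _⟦_⟧ : Context ρ → Tree ρ → Tree ρ
  C ⟦ s ⟧ = substitute (Context.tree C) s

  -- For t = C ⟦ s ⟧, the nodes of t lying in the subtree s.
  InSubtree : Context ρ → Tree ρ → Node → Set
  InSubtree C t η = Dom t η × (∀ {a} → Labelled (Context.tree C) η a → a ≡ nothing)

------------------------------------------------------------------------
-- Bottom-up non-deterministic tree automata

module _ (𝔸 : RankedAlphabet) where
  open RankedAlphabet 𝔸

  record NTA : Set where
    field
      states      : ℕ
      transitions : List (Σ[ a ∈ Symbol ] Vec (Fin states) (rank a) × Fin states)
      final       : Subset states

module _ {𝔸 : RankedAlphabet} (𝒯 : NTA 𝔸) where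
  open RankedAlphabet 𝔸
  open NTA 𝒯

  data _⇒_ : Tree rank → Fin states → Set where
    apply : ∀ {a qs q ts} → (a , qs , q) ∈ transitions →
            Pointwise _⇒_ ts qs → node a ts ⇒ q

  Accepts : Tree rank → Set
  Accepts t = ∃[ q ] q ∈ˢ final × t ⇒ q

------------------------------------------------------------------------
-- Counters

data Comparison : Set where
  lt le eq ge gt : Comparison

-- The constant `tt` is the empty conjunction; it matters only when there
-- are no counters, and hence no atoms.

data Constraint (c : ℕ) : Set where
  tt      : Constraint c
  atom    : Fin c → Comparison → ℤ → Constraint c
  not     : Constraint c → Constraint c
  and or  : Constraint c → Constraint c → Constraint c

Valuation : ℕ → Set
Valuation c = Vec ℤ c

compare : Comparison → ℤ → ℤ → Set
compare lt = ℤ._<_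
compare le = ℤ._≤_
compare eq = _≡_
compare ge = ℤ._≥_
compare gt = ℤ._>_

Holds : ∀ {c} → Constraint c → Valuation c → Set
Holds tt           ν = ⊤
Holds (atom k ∼ v) ν = compare ∼ (lookup ν k) v
Holds (not θ)      ν = ¬ Holds θ ν
Holds (and θ θ′)   ν = Holds θ ν × Holds θ′ ν
Holds (or θ θ′)    ν = Holds θ ν ⊎ Holds θ′ ν

-- The blocks of the partition may be empty, so that sequences with fewer
-- than r + 1 elements are not excluded.

ReversalBounded : ∀ {c} → ℕ → Fin c → List (Valuation c) → Set
ReversalBounded {c} r k νs =
  Σ[ blocks ∈ Vec (List (Valuation c)) (suc r) ]
    νs ≡ List.concat (Vec.toList blocks) ×
    Vec.All (λ A → Linked (λ ν ν′ → lookup ν k ℤ.≤ lookup ν′ k) A ⊎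
                   Linked (λ ν ν′ → lookup ν k ℤ.≥ lookup ν′ k) A) blocks

------------------------------------------------------------------------
-- rbGTRS

record Rule (𝔸 : RankedAlphabet) (states outputs counters : ℕ) : Set where
  field
    source target : Fin states
    lhs rhs       : NTA 𝔸
    guard         : Constraint counters
    output        : Fin outputs
    update        : Vec ℤ counters

record RbGTRS : Set where
  field
    states    : ℕ
    alphabet  : RankedAlphabet
    outputs   : ℕ
    counters  : ℕ
    rules     : List (Rule alphabet states outputs counters)
    reversals : ℕ

module _ (G : RbGTRS) where
  open RbGTRS G
  open RankedAlphabet alphabet

  record Configuration : Set where
    constructor ⟪_,_,_⟫
    field
      state     : Fin states
      tree      : Tree rank
      valuation : Valuation counters

  open Configuration

  record Transition (γ : Fin outputs) (c c′ : Configuration) : Set where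
    field
      rule          : Rule alphabet states outputs counters
    open Rule rule
    field
      rule∈         : rule ∈ rules
      output≡       : output ≡ γ
      source≡       : source ≡ state c
      target≡       : target ≡ state c′
      guardHolds    : Holds guard (valuation c)
      valuation≡    : valuation c′ ≡ zipWith ℤ._+_ (valuation c) update
      context       : Context rank
      tᵒᵘᵗ tⁱⁿ      : Tree rank
      lhsAccepts    : Accepts lhs tᵒᵘᵗ
      rhsAccepts    : Accepts rhs tⁱⁿ
      tree≡         : tree c  ≡ context ⟦ tᵒᵘᵗ ⟧
      tree′≡        : tree c′ ≡ context ⟦ tⁱⁿ ⟧

  -- A run with n transitions.  Positions are numbered from 0, so transition
  -- i leads from position i to position i + 1.
  record Run (n : ℕ) : Set where
    field
      conf : Fin (suc n) → Configuration
      step : ∀ i → ∃[ γ ] Transition γ (conf (inject₁ i)) (conf (suc i))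
      reversalBounded :
        ∀ k → ReversalBounded reversals k (List.tabulate (valuation ∘ conf))

  module _ {n : ℕ} (run : Run n) where
    open Run run

    contextAt : Fin n → Context rank
    contextAt i = Transition.context (proj₂ (step i))

    -- The node lies in the subtree newly written at the given position.
    WrittenAt : Fin (suc n) → Node → Set
    WrittenAt zero    η = ⊥
    WrittenAt (suc i) η = InSubtree (contextAt i) (tree (conf (suc i))) η

    Birthdate : Fin (suc n) → Node → Fin (suc n) → Set
    Birthdate i η j =
      (WrittenAt j η × j Fin.≤ i × (∀ k → WrittenAt k η → k Fin.≤ i → k Fin.≤ j))
      ⊎
      (j ≡ zero × (∀ k → WrittenAt k η → ¬ k Fin.≤ i))

    -- The number of control-state changes between positions j and i.
    stateChanges : Fin (suc n) → Fin (suc n) → ℕ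
    stateChanges j i = List.length (List.filter change? (List.allFin n))
      where
      change? = λ (k : Fin n) →
        j Fin.≤? inject₁ k ×-dec inject₁ k Fin.<? i ×-dec
        ¬? (state (conf (inject₁ k)) Fin.≟ state (conf (suc k)))

    LifespanRestricted : ℕ → Set
    LifespanRestricted ℓ =
      ∀ (i : Fin n) η →
      InSubtree (contextAt i) (tree (conf (inject₁ i))) η →
      ∀ j → Birthdate (inject₁ i) η j → stateChanges j (inject₁ i) ≤ ℓ

------------------------------------------------------------------------
-- Control-state reachability for senescent rbGTRS

record Instance : Set where
  field
    system   : RbGTRS
    lifespan : ℕ
    p₁ p₂    : Fin (RbGTRS.states system)
    t₁       : Tree (RankedAlphabet.rank (RbGTRS.alphabet system))

Reachable : Instance → Set
Reachable I =
  ∃₂ λ t₂ ν₂ → ∃[ n ] Σ[ run ∈ Run system n ]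
    Run.conf run zero       ≡ ⟪ p₁ , t₁ , replicate counters 0ℤ ⟫ ×
    Run.conf run (fromℕ n)  ≡ ⟪ p₂ , t₂ , ν₂ ⟫ ×
    LifespanRestricted system run lifespan
  where
  open Instance I
  open RbGTRS system

------------------------------------------------------------------------
-- Algorithms: Minsky register machines with arbitrarily many registers,
-- halting with a yes/no answer

data Instruction (labels registers : ℕ) : Set where
  inc  : Fin registers → Fin labels → Instruction labels registers
  -- dec r l l′: if r is positive, decrement it and go to l; else go to l′
  dec  : Fin registers → Fin labels → Fin labels → Instruction labels registers
  halt : Bool → Instruction labels registers

record Machine : Set where
  field
    labels    : ℕ
    others    : ℕ

  -- register zero receives the input
  registers : ℕ
  registers = suc others

  field
    start   : Fin labels
    program : Vec (Instruction labels registers) labels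

module _ (M : Machine) where
  open Machine M

  MachineState : Set
  MachineState = Fin labels × Vec ℕ registers

  data _⟶_ : MachineState → MachineState → Set where
    inc   : ∀ {l r l′ v} → lookup program l ≡ inc r l′ →
            (l , v) ⟶ (l′ , v [ r ]≔ suc (lookup v r))
    dec   : ∀ {l r l′ l″ v m} → lookup program l ≡ dec r l′ l″ →
            lookup v r ≡ suc m → (l , v) ⟶ (l′ , v [ r ]≔ m)
    jzero : ∀ {l r l′ l″ v} → lookup program l ≡ dec r l′ l″ →
            lookup v r ≡ 0 → (l , v) ⟶ (l″ , v)

  Answers : ℕ → Bool → Set
  Answers input b = ∃₂ λ l v →
    Star _⟶_ (start , input ∷ replicate others 0) (l , v) ×
    lookup program l ≡ halt b

-- M halts on the code of every x : A, answering whether P x.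
Decides : {A : Set} → Machine → A ↣ ℕ → (A → Set) → Set
Decides M encoding P =
  ∀ x → ∃[ b ] Answers M (Injection.to encoding x) b × Reflects (P x) b

AlgorithmicallyDecidable : {A : Set} → A ↣ ℕ → (A → Set) → Set
AlgorithmicallyDecidable encoding P = ∃[ M ] Decides M encoding P

------------------------------------------------------------------------
-- Encoding of instances as natural numbers

open Injection using (to; injective)

-- Every positive number is ⟨ m , n ⟩ for unique m and n.
⟨_,_⟩ : ℕ → ℕ → ℕ
⟨ m , n ⟩ = 2 ^ m * suc (2 * n)

⟨,⟩-injective : ∀ m n m′ n′ → ⟨ m , n ⟩ ≡ ⟨ m′ , n′ ⟩ → m ≡ m′ × n ≡ n′
⟨,⟩-injective zero n zero n′ e =
  refl , *-cancelˡ-≡ n n′ 2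
    (suc-injective (trans (sym (*-identityˡ _)) (trans e (*-identityˡ _))))
⟨,⟩-injective zero n (suc m′) n′ e = contradiction
  (trans (sym (*-assoc 2 (2 ^ m′) _)) (trans (sym e) (*-identityˡ _)))
  (even≢odd ⟨ m′ , n′ ⟩ n)
⟨,⟩-injective (suc m) n zero n′ e = contradiction
  (trans (sym (*-assoc 2 (2 ^ m) _)) (trans e (*-identityˡ _)))
  (even≢odd ⟨ m , n ⟩ n′)
⟨,⟩-injective (suc m) n (suc m′) n′ e
  with refl , q ← ⟨,⟩-injective m n m′ n′
         (*-cancelˡ-≡ ⟨ m , n ⟩ ⟨ m′ , n′ ⟩ 2
           (trans (sym (*-assoc 2 (2 ^ m) _)) (trans e (*-assoc 2 (2 ^ m′) _))))
  = refl , q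

⟨,⟩≢0 : ∀ m n → ⟨ m , n ⟩ ≢ 0
⟨,⟩≢0 (suc m) n e =
  ⟨,⟩≢0 m n (*-cancelˡ-≡ ⟨ m , n ⟩ 0 2 (trans (sym (*-assoc 2 (2 ^ m) _)) e))

ℕ↣ℕ : ℕ ↣ ℕ
ℕ↣ℕ = mk↣ {to = id} id

Fin↣ℕ : ∀ {n} → Fin n ↣ ℕ
Fin↣ℕ = mk↣ Fin.toℕ-injective

Bool↣ℕ : Bool ↣ ℕ
Bool↣ℕ = mk↣ {to = code} inj
  where
  code : Bool → ℕ
  code false = 0
  code true  = 1

  inj : ∀ {b b′} → code b ≡ code b′ → b ≡ b′
  inj {false} {false} refl = refl
  inj {true}  {true}  refl = refl

ℤ↣ℕ : ℤ ↣ ℕ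
ℤ↣ℕ = mk↣ {to = code} inj
  where
  code : ℤ → ℕ
  code (+ n)    = ⟨ 0 , n ⟩
  code -[1+ n ] = ⟨ 1 , n ⟩

  inj : ∀ {i j} → code i ≡ code j → i ≡ j
  inj { + m }     { + n }     e = cong +_ (proj₂ (⟨,⟩-injective 0 m 0 n e))
  inj { + m }     { -[1+ n ]} e with () ← proj₁ (⟨,⟩-injective 0 m 1 n e)
  inj { -[1+ m ]} { + n }     e with () ← proj₁ (⟨,⟩-injective 1 m 0 n e)
  inj { -[1+ m ]} { -[1+ n ]} e = cong -[1+_] (proj₂ (⟨,⟩-injective 1 m 1 n e))

infixr 4 _,↣_
_,↣_ : {A : Set} {B : A → Set} → A ↣ ℕ → (∀ {a} → B a ↣ ℕ) → ∃ B ↣ ℕ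
_,↣_ {A} {B} f g = mk↣ {to = code} inj
  where
  code : ∃ B → ℕ
  code (a , b) = ⟨ to f a , to g b ⟩

  inj : ∀ {x y} → code x ≡ code y → x ≡ y
  inj {a , b} {a′ , b′} e with p , q ← ⟨,⟩-injective _ (to g b) _ (to g b′) e
    with refl ← injective f p = cong (a ,_) (injective g q)

module _ {A : Set} (f : A ↣ ℕ) where

  List↣ℕ : List A ↣ ℕ
  List↣ℕ = mk↣ {to = code} inj
    where
    code : List A → ℕ
    code []       = 0
    code (x ∷ xs) = ⟨ to f x , code xs ⟩

    inj : ∀ {xs ys} → code xs ≡ code ys → xs ≡ ys
    inj {[]}     {[]}     e = refl
    inj {[]}     {y ∷ ys} e = contradiction (sym e) (⟨,⟩≢0 (to f y) (code ys))
    inj {x ∷ xs} {[]}     e = contradiction e (⟨,⟩≢0 (to f x) (code xs))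
    inj {x ∷ xs} {y ∷ ys} e
      with p , q ← ⟨,⟩-injective (to f x) (code xs) (to f y) (code ys) e
      = cong₂ _∷_ (injective f p) (inj q)

  Vec↣ℕ : ∀ {n} → Vec A n ↣ ℕ
  Vec↣ℕ = mk↣ {to = code} inj
    where
    code : ∀ {n} → Vec A n → ℕ
    code []       = 0
    code (x ∷ xs) = ⟨ to f x , code xs ⟩

    inj : ∀ {n} {xs ys : Vec A n} → code xs ≡ code ys → xs ≡ ys
    inj {xs = []}     {[]}     e = refl
    inj {xs = x ∷ xs} {y ∷ ys} e
      with p , q ← ⟨,⟩-injective (to f x) (code xs) (to f y) (code ys) e
      = cong₂ _∷_ (injective f p) (inj q)

  Tree↣ℕ : {ρ : A → ℕ} → Tree ρ ↣ ℕ
  Tree↣ℕ {ρ} = mk↣ {to = code} inj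
    where
    mutual
      code : Tree ρ → ℕ
      code (node a ts) = ⟨ to f a , codes ts ⟩

      codes : ∀ {n} → Vec (Tree ρ) n → ℕ
      codes []       = 0
      codes (t ∷ ts) = ⟨ code t , codes ts ⟩

    mutual
      inj : ∀ {s t} → code s ≡ code t → s ≡ t
      inj {node a ss} {node b ts} e
        with p , q ← ⟨,⟩-injective (to f a) (codes ss) (to f b) (codes ts) e
        with refl ← injective f p = cong (node a) (injs q)

      injs : ∀ {n} {ss ts : Vec (Tree ρ) n} → codes ss ≡ codes ts → ss ≡ ts
      injs {ss = []}     {[]}     e = refl
      injs {ss = s ∷ ss} {t ∷ ts} e
        with p , q ← ⟨,⟩-injective (code s) (codes ss) (code t) (codes ts) e
        = cong₂ _∷_ (inj p) (injs q)

Comparison↣ℕ : Comparison ↣ ℕ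
Comparison↣ℕ = mk↣ {to = code} inj
  where
  code : Comparison → ℕ
  code lt = 0
  code le = 1
  code eq = 2
  code ge = 3
  code gt = 4

  inj : ∀ {x y} → code x ≡ code y → x ≡ y
  inj {lt} {lt} refl = refl
  inj {le} {le} refl = refl
  inj {eq} {eq} refl = refl
  inj {ge} {ge} refl = refl
  inj {gt} {gt} refl = refl

Constraint↣ℕ : ∀ {c} → Constraint c ↣ ℕ
Constraint↣ℕ {c} = mk↣ {to = code} (λ {θ} {θ′} → inj θ θ′)
  where
  atom↣ℕ : (Fin c × Comparison × ℤ) ↣ ℕ
  atom↣ℕ = Fin↣ℕ ,↣ Comparison↣ℕ ,↣ ℤ↣ℕ

  tag : Constraint c → ℕ
  tag tt           = 0
  tag (atom _ _ _) = 1
  tag (not _)      = 2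
  tag (and _ _)    = 3
  tag (or _ _)     = 4

  mutual
    code : Constraint c → ℕ
    code θ = ⟨ tag θ , arguments θ ⟩

    arguments : Constraint c → ℕ
    arguments tt           = 0
    arguments (atom k ∼ v) = to atom↣ℕ (k , ∼ , v)
    arguments (not θ)      = code θ
    arguments (and θ θ′)   = ⟨ code θ , code θ′ ⟩
    arguments (or θ θ′)    = ⟨ code θ , code θ′ ⟩

  mutual
    inj : ∀ θ θ′ → code θ ≡ code θ′ → θ ≡ θ′
    inj θ θ′ e with p , q ← ⟨,⟩-injective (tag θ) (arguments θ) (tag θ′) (arguments θ′) e
      = inj′ θ θ′ p q

    inj′ : ∀ θ θ′ → tag θ ≡ tag θ′ → arguments θ ≡ arguments θ′ → θ ≡ θ′
    inj′ tt           tt              refl q = refl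
    inj′ (atom k ∼ v) (atom k′ ∼′ v′) refl q
      with refl ← injective atom↣ℕ {k , ∼ , v} {k′ , ∼′ , v′} q = refl
    inj′ (not θ)      (not θ′)        refl q = cong not (inj θ θ′ q)
    inj′ (and θ₁ θ₂)  (and θ₁′ θ₂′)   refl q
      with q₁ , q₂ ← ⟨,⟩-injective (code θ₁) (code θ₂) (code θ₁′) (code θ₂′) q
      = cong₂ and (inj θ₁ θ₁′ q₁) (inj θ₂ θ₂′ q₂)
    inj′ (or θ₁ θ₂)   (or θ₁′ θ₂′)    refl q
      with q₁ , q₂ ← ⟨,⟩-injective (code θ₁) (code θ₂) (code θ₁′) (code θ₂′) q
      = cong₂ or (inj θ₁ θ₁′ q₁) (inj θ₂ θ₂′ q₂)

-- Encoding of a type with a left-invertible map into an encoded type.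
via : {A B : Set} (f : A → B) (g : B → A) → (∀ x → g (f x) ≡ x) → B ↣ ℕ → A ↣ ℕ
via f g g∘f encoding = mk↣ {to = to encoding ∘ f} λ {x} {y} e →
  trans (sym (g∘f x)) (trans (cong g (injective encoding e)) (g∘f y))

RankedAlphabet↣ℕ : RankedAlphabet ↣ ℕ
RankedAlphabet↣ℕ = via
  (λ 𝔸 → let open RankedAlphabet 𝔸 in size , ranks)
  (λ (size , ranks) → record { size = size ; ranks = ranks })
  (λ _ → refl)
  (ℕ↣ℕ ,↣ Vec↣ℕ ℕ↣ℕ)

NTA↣ℕ : ∀ {𝔸} → NTA 𝔸 ↣ ℕ
NTA↣ℕ = via
  (λ 𝒯 → let open NTA 𝒯 in states , transitions , final)
  (λ (states , transitions , final) → record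
    { states = states ; transitions = transitions ; final = final })
  (λ _ → refl)
  (ℕ↣ℕ ,↣ List↣ℕ (Fin↣ℕ ,↣ Vec↣ℕ Fin↣ℕ ,↣ Fin↣ℕ) ,↣ Vec↣ℕ Bool↣ℕ)

Rule↣ℕ : ∀ {𝔸 s o c} → Rule 𝔸 s o c ↣ ℕ
Rule↣ℕ = via
  (λ R → let open Rule R in source , target , lhs , rhs , guard , output , update)
  (λ (source , target , lhs , rhs , guard , output , update) → record
    { source = source ; target = target ; lhs = lhs ; rhs = rhs
    ; guard = guard ; output = output ; update = update })
  (λ _ → refl)
  (Fin↣ℕ ,↣ Fin↣ℕ ,↣ NTA↣ℕ ,↣ NTA↣ℕ ,↣ Constraint↣ℕ ,↣ Fin↣ℕ ,↣ Vec↣ℕ ℤ↣ℕ)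

RbGTRS↣ℕ : RbGTRS ↣ ℕ
RbGTRS↣ℕ = via
  (λ G → let open RbGTRS G in
    states , alphabet , outputs , counters , rules , reversals)
  (λ (states , alphabet , outputs , counters , rules , reversals) → record
    { states = states ; alphabet = alphabet ; outputs = outputs
    ; counters = counters ; rules = rules ; reversals = reversals })
  (λ _ → refl)
  (ℕ↣ℕ ,↣ RankedAlphabet↣ℕ ,↣ ℕ↣ℕ ,↣ ℕ↣ℕ ,↣ List↣ℕ Rule↣ℕ ,↣ ℕ↣ℕ)

Instance↣ℕ : Instance ↣ ℕ
Instance↣ℕ = via
  (λ I → let open Instance I in system , lifespan , p₁ , p₂ , t₁)
  (λ (system , lifespan , p₁ , p₂ , t₁) → record
    { system = system ; lifespan = lifespan ; p₁ = p₁ ; p₂ = p₂ ; t₁ = t₁ })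
  (λ _ → refl)
  (RbGTRS↣ℕ ,↣ ℕ↣ℕ ,↣ Fin↣ℕ ,↣ Fin↣ℕ ,↣ Tree↣ℕ Fin↣ℕ)

{-# OPTIONS --safe #-}
-- A register machine N is simulated by a system with lifespan 1: a unit in
-- register r is a leaf labelled r, and in each state of N the leaves can be
-- refreshed by rewriting them to themselves.  Two counters, whose initial
-- value is guessed, count the leaves created and removed; requiring them to
-- be zero at the end forces that no register leaf is left, and so that no
-- such leaf ever becomes too old to be rewritten.  A zero test of r consists
-- of two state changes between which the leaves labelled r cannot be
-- refreshed, so it must happen when there are none.  The input n is given as
-- a chain of n nodes in the initial tree, measured by a third counter.  All
-- counters first only grow and then only shrink, so one reversal suffices.
--
-- If a machine M decided reachability, let N map n to the code of the instance
-- with system coded by n and initial chain of length n, run M on it and negate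
-- the answer.  Taking for n the code of the system that simulates N gives a
-- contradiction.

module Submission where

open import Defs
open import Data.Bool.Base as Bool using (Bool; true; false; if_then_else_)
open import Data.Empty using (⊥; ⊥-elim)
open import Data.Fin.Base as Fin
  using (Fin; zero; suc; toℕ; inject₁; fromℕ; _↑ˡ_; _↑ʳ_; splitAt; punchIn; punchOut)
import Data.Fin.Induction as Fin
import Data.Fin.Properties as Fin
open import Data.Fin.Subset using (inside) renaming (⊥ to ∅)
open import Data.Fin.Subset.Properties using (∉⊥)
open import Data.Integer.Base as ℤ using (ℤ; +_; 0ℤ; 1ℤ; -1ℤ; +≤+)
import Data.Integer.Properties as ℤ
import Data.Integer.Tactic.RingSolver as ℤ-Solver
open import Data.List.Base as List using (List; []; _∷_; _++_)
open import Data.List.Membership.Propositional using (_∈_)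
open import Data.List.Membership.Propositional.Properties
import Data.List.Properties as List
open import Data.List.Relation.Unary.Any using (here; there)
open import Data.List.Relation.Unary.Linked as Linked using (Linked)
open import Data.Maybe.Base using (Maybe; just; nothing)
open import Data.Nat.Base using (ℕ; zero; suc; _+_; _*_; _^_; _≤_; z≤n; s≤s)
import Data.Nat.Properties as ℕ
import Data.Nat.Tactic.RingSolver as ℕ-Solver
open import Data.Product hiding (zipWith)
open import Data.Sum.Base using (_⊎_; inj₁; inj₂; [_,_]′)
open import Data.Unit.Base using (⊤; tt)
open import Data.Vec.Base
  using (Vec; []; _∷_; here; there; lookup; replicate; tabulate; zipWith; _[_]≔_)
import Data.Vec.Properties as Vec
open import Data.Vec.Relation.Binary.Pointwise.Inductive as Pointwise using (Pointwise)
import Data.Vec.Relation.Unary.All as Vec using ([]; _∷_)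
open import Function.Base using (_∘_; id; case_of_)
open import Function.Bundles using (_⇔_; mk⇔; _↣_; Equivalence; Injection)
open import Relation.Binary.Construct.Closure.ReflexiveTransitive as Star
  using (Star; ε; _◅_; _◅◅_)
open import Relation.Binary.PropositionalEquality
open import Relation.Nullary
open import Relation.Unary using (Decidable)

-- Contexts as zippers

-- Age never stops a run: a unit neglected for too long is merely frozen in the tree, so a wrong
-- zero test cannot be noticed when it is made. Only the end of the run rules it out, and therefore
-- soundness is proved from the last configuration backwards. Reversal-bounded counters cannot
-- follow a register that goes up and down; they count outstanding creations and removals
-- separately, and each of these numbers only falls once it has been guessed. The input enters
-- through the tree so that the rules depend on `N` alone. With the input built into the rules, `N`
-- would have to compute the code of a set of rules; as it is, the code of the system is copied
-- without being decoded, and only the code of a chain has to be built. Birthdates are maxima over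
-- earlier positions, which is awkward for induction along a run. They are replaced by an age
-- function on addresses of nodes that each step updates.

vec-ext : ∀ {X : Set} {n} {xs ys : Vec X n} → (∀ i → lookup xs i ≡ lookup ys i) → xs ≡ ys
vec-ext {xs = xs} {ys} e = trans (sym (Vec.tabulate∘lookup xs))
  (trans (Vec.tabulate-cong e) (Vec.tabulate∘lookup ys))

infix 4 _⊑_
_⊑_ : Node → Node → Set
π ⊑ η = ∃ λ η′ → π ++ η′ ≡ η

_⊑?_ : ∀ π η → Dec (π ⊑ η)
[]      ⊑? η  = yes (η , refl)
(i ∷ π) ⊑? [] = no λ ()
(i ∷ π) ⊑? (j ∷ η) with i ℕ.≟ j | π ⊑? η
... | yes refl | yes (η′ , refl) = yes (η′ , refl)
... | yes refl | no π⋢η = no λ { (η′ , refl) → π⋢η (η′ , refl) }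
... | no i≢j   | _      = no λ { (η′ , refl) → i≢j refl }

child-inv : ∀ {A : Set} {ρ : A → ℕ} {a ts k η b} → Labelled {ρ = ρ} (node a ts) (k ∷ η) b →
            ∃ λ i → k ≡ suc (toℕ i) × Labelled (lookup ts i) η b
child-inv (child i l) = i , refl , l

-- A frame keeps a full vector of children, and `plug` overwrites its entry `i`, whose value is
-- arbitrary. Several zippers thus describe one context, which is why contexts are tied to zippers
-- by the relation `_≈_` rather than by a bijection.
data Zipper {A : Set} (ρ : A → ℕ) : Set where
  hole : Zipper ρ
  down : (a : A) (i : Fin (ρ a)) (ts : Vec (Tree ρ) (ρ a)) → Zipper ρ → Zipper ρ

module _ {A : Set} {ρ : A → ℕ} where

  plug : Zipper ρ → Tree ρ → Tree ρ
  plug hole           s = s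
  plug (down a i ts z) s = node a (ts [ i ]≔ plug z s)

  path : Zipper ρ → Node
  path hole            = []
  path (down a i ts z) = suc (toℕ i) ∷ path z

  labelled-inside : ∀ z {s η b} → Labelled s η b → Labelled (plug z s) (path z ++ η) b
  labelled-inside hole l = l
  labelled-inside (down a i ts z) l = child i
    (subst (λ t → Labelled t _ _) (sym (Vec.lookup∘update i ts _)) (labelled-inside z l))

  labelled-outside : ∀ z {s s′ η b} → ¬ path z ⊑ η →
                     Labelled (plug z s) η b → Labelled (plug z s′) η b
  labelled-outside hole out l = ⊥-elim (out (_ , refl))
  labelled-outside (down a i ts z) out root = root
  labelled-outside (down a i ts z) {s} {s′} out (child j l) with i Fin.≟ j
  ... | yes refl = child i (subst (λ t → Labelled t _ _) (sym (Vec.lookup∘update i ts _))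
          (labelled-outside z (λ { (η′ , refl) → out (η′ , refl) })
            (subst (λ t → Labelled t _ _) (Vec.lookup∘update i ts _) l)))
  ... | no i≢j = child j (subst (λ t → Labelled t _ _)
          (trans (Vec.lookup∘update′ (≢-sym i≢j) ts _)
            (sym (Vec.lookup∘update′ (≢-sym i≢j) ts _))) l)

  labelled-below : ∀ z {s η b} → Labelled (plug z s) (path z ++ η) b → Labelled s η b
  labelled-below hole l = l
  labelled-below (down a i ts z) l with child-inv l
  ... | j , e , l′ with refl ← Fin.toℕ-injective (ℕ.suc-injective e) =
    labelled-below z (subst (λ t → Labelled t _ _) (Vec.lookup∘update i ts _) l′)

  focus : ∀ {t : Tree ρ} {η a} → Labelled t η a →
          ∃₂ λ z ts → path z ≡ η × t ≡ plug z (node a ts)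
  focus root = hole , _ , refl , refl
  focus (child {a} {ts} i l) with focus l
  ... | z , us , refl , e = down a i ts z , us , refl ,
    cong (node a) (trans (sym (Vec.[]≔-lookup ts i)) (cong (ts [ i ]≔_) e))

  -- Trees with a variable and the zippers that represent them

  mutual
    embed : Tree ρ → Tree (withVar ρ)
    embed (node a ts) = node (just a) (embeds ts)

    embeds : ∀ {n} → Vec (Tree ρ) n → Vec (Tree (withVar ρ)) n
    embeds []       = []
    embeds (t ∷ ts) = embed t ∷ embeds ts

  lookup-embeds : ∀ {n} (ts : Vec (Tree ρ) n) i → lookup (embeds ts) i ≡ embed (lookup ts i)
  lookup-embeds (t ∷ ts) zero    = refl
  lookup-embeds (t ∷ ts) (suc i) = lookup-embeds ts i

  mutual
    substitute-embed : ∀ t s → substitute (embed t) s ≡ t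
    substitute-embed (node a ts) s = cong (node a) (substitutes-embeds ts s)

    substitutes-embeds : ∀ {n} (ts : Vec (Tree ρ) n) s → substitutes (embeds ts) s ≡ ts
    substitutes-embeds []       s = refl
    substitutes-embeds (t ∷ ts) s = cong₂ _∷_ (substitute-embed t s) (substitutes-embeds ts s)

  lookup-substitutes : ∀ {n} (us : Vec (Tree (withVar ρ)) n) s i →
                       lookup (substitutes us s) i ≡ substitute (lookup us i) s
  lookup-substitutes (u ∷ us) s zero    = refl
  lookup-substitutes (u ∷ us) s (suc i) = lookup-substitutes us s i

  labelled-embed : ∀ {t : Tree ρ} {η a} → Labelled t η a → Labelled (embed t) η (just a)
  labelled-embed root = root
  labelled-embed (child {a} {ts} i l) = child i
    (subst (λ u → Labelled u _ _) (sym (lookup-embeds ts i)) (labelled-embed l))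

  embed-noVar : ∀ t {η} → ¬ Labelled (embed t) η nothing
  embed-noVar (node a ts) (child i l) =
    embed-noVar (lookup ts i) (subst (λ u → Labelled u _ _) (lookup-embeds ts i) l)

  mutual
    strip : ∀ u → (∀ {η} → ¬ Labelled u η nothing) → ∃ λ t → u ≡ embed t
    strip (node nothing us) none = ⊥-elim (none root)
    strip (node (just a) us) none with strips us (λ i l → none (child i l))
    ... | ts , refl = node a ts , refl

    strips : ∀ {n} (us : Vec (Tree (withVar ρ)) n) →
             (∀ i {η} → ¬ Labelled (lookup us i) η nothing) → ∃ λ ts → us ≡ embeds ts
    strips []       none = [] , refl
    strips (u ∷ us) none with strip u (none zero) | strips us (λ i → none (suc i))
    ... | t , refl | ts , refl = t ∷ ts , refl

  infix 4 _≈_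
  data _≈_ : Tree (withVar ρ) → Zipper ρ → Set where
    hole : ∀ {us} → node nothing us ≈ hole
    down : ∀ {a i us ts z} → lookup us i ≈ z →
           (∀ j → j ≢ i → lookup us j ≡ embed (lookup ts j)) →
           node (just a) us ≈ down a i ts z

  ≈-substitute : ∀ {u z} → u ≈ z → ∀ s → substitute u s ≡ plug z s
  ≈-substitute (hole {[]}) s = refl
  ≈-substitute (down {a} {i} {us} {ts} {z} u≈z others) s = cong (node a) (vec-ext same)
    where
    same : ∀ j → lookup (substitutes us s) j ≡ lookup (ts [ i ]≔ plug z s) j
    same j with j Fin.≟ i
    ... | yes refl = trans (lookup-substitutes us s i)
      (trans (≈-substitute u≈z s) (sym (Vec.lookup∘update i ts _)))
    ... | no j≢i = trans (lookup-substitutes us s j)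
      (trans (cong (λ u → substitute u s) (others j j≢i))
        (trans (substitute-embed _ s) (sym (Vec.lookup∘update′ j≢i ts _))))

  ≈-var : ∀ {u z} → u ≈ z → Labelled u (path z) nothing
  ≈-var hole = root
  ≈-var (down u≈z others) = child _ (≈-var u≈z)

  ≈-below : ∀ {u z η a} → u ≈ z → Labelled u (path z ++ η) a → a ≡ nothing
  ≈-below hole root = refl
  ≈-below (down u≈z others) l with child-inv l
  ... | j , e , l′ with refl ← Fin.toℕ-injective (ℕ.suc-injective e) = ≈-below u≈z l′

  ≈-unique : ∀ {u z η} → u ≈ z → Labelled u η nothing → path z ≡ η
  ≈-unique hole root = refl
  ≈-unique (down {i = i} {ts = ts} u≈z others) (child j l) with j Fin.≟ i
  ... | yes refl = cong (suc (toℕ i) ∷_) (≈-unique u≈z l)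
  ... | no j≢i = ⊥-elim (embed-noVar (lookup ts j)
                   (subst (λ u → Labelled u _ _) (others j j≢i) l))

  ≈-outside : ∀ {u z s η b} → u ≈ z → ¬ path z ⊑ η →
              Labelled (plug z s) η b → Labelled u η (just b)
  ≈-outside hole out l = ⊥-elim (out (_ , refl))
  ≈-outside (down u≈z others) out root = root
  ≈-outside (down {i = i} {ts = ts} u≈z others) out (child j l) with j Fin.≟ i
  ... | yes refl = child i (≈-outside u≈z (λ { (η′ , refl) → out (η′ , refl) })
                     (subst (λ t → Labelled t _ _) (Vec.lookup∘update i ts _) l))
  ... | no j≢i = child j (subst (λ u → Labelled u _ _) (sym (others j j≢i))
                   (labelled-embed (subst (λ t → Labelled t _ _) (Vec.lookup∘update′ j≢i ts _) l)))

  holed : Zipper ρ → Tree (withVar ρ)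
  holed hole            = node nothing []
  holed (down a i ts z) = node (just a) (embeds ts [ i ]≔ holed z)

  holed-≈ : ∀ z → holed z ≈ z
  holed-≈ hole = hole
  holed-≈ (down a i ts z) = down
    (subst (_≈ z) (sym (Vec.lookup∘update i (embeds ts) _)) (holed-≈ z))
    (λ j j≢i → trans (Vec.lookup∘update′ j≢i (embeds ts) _) (lookup-embeds ts j))

  toContext : Zipper ρ → Context ρ
  toContext z = record
    { tree = holed z
    ; uniqueVar = path z , ≈-var (holed-≈ z) , ≈-unique (holed-≈ z) }

  -- The tree d fills the irrelevant position of each zipper frame.
  zipper : ∀ {u η} → Tree ρ → Labelled u η nothing →
           (∀ {η′} → Labelled u η′ nothing → η ≡ η′) → ∃ λ z → u ≈ z
  zipper d root unique = hole , hole
  zipper d (child {nothing} () l) unique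
  zipper d (child {just a} {us} {η} i l) unique
    with zipper d l (λ l′ → List.∷-injectiveʳ (unique (child i l′)))
  ... | z , u≈z = down a i (tabulate sibling) z , down u≈z
        (λ j j≢i → trans (sibling-embed j j≢i) (cong embed (sym (Vec.lookup∘tabulate sibling j))))
    where
    -- A variable in another child would be a second occurrence, at an address that differs in its
    -- first entry.
    stripped : ∀ j → j ≢ i → ∃ λ t → lookup us j ≡ embed t
    stripped j j≢i = strip (lookup us j) λ l′ → j≢i (Fin.toℕ-injective
      (ℕ.suc-injective (sym (List.∷-injectiveˡ (unique (child j l′))))))

    sibling : Fin (ρ a) → Tree ρ
    sibling j with j Fin.≟ i
    ... | yes _  = d
    ... | no j≢i = proj₁ (stripped j j≢i)

    sibling-embed : ∀ j → j ≢ i → lookup us j ≡ embed (sibling j)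
    sibling-embed j j≢i with j Fin.≟ i
    ... | yes j≡i = ⊥-elim (j≢i j≡i)
    ... | no j≢i′ = proj₂ (stripped j j≢i′)

  fromContext : Tree ρ → (C : Context ρ) → ∃ λ z → Context.tree C ≈ z
  fromContext d C = let _ , l , unique = Context.uniqueVar C in zipper d l unique

  -- A node not below the hole carries a proper symbol in the context, so `InSubtree` fails for it.
  -- Together with the converse below, membership in the rewritten subtree becomes a prefix test on
  -- addresses.
  inSubtree⇒⊑ : ∀ {C : Context ρ} {z s η} → Context.tree C ≈ z →
                InSubtree C (plug z s) η → path z ⊑ η
  inSubtree⇒⊑ {z = z} {η = η} C≈z ((a , l) , only) with path z ⊑? η
  ... | yes p = p
  ... | no p with () ← only (≈-outside C≈z p l)

  ⊑⇒inSubtree : ∀ {C : Context ρ} {z t η} → Context.tree C ≈ z →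
                path z ⊑ η → Dom t η → InSubtree C t η
  ⊑⇒inSubtree C≈z (_ , refl) d = d , λ l → ≈-below C≈z l

-- Runs as sequences of steps between configurations with ages

indicator : {P : Set} → Dec P → ℕ
indicator P? = if does P? then 1 else 0

indicator-cong : ∀ {P Q : Set} (P? : Dec P) (Q? : Dec Q) → P ⇔ Q → indicator P? ≡ indicator Q?
indicator-cong (yes p) (yes q) P⇔Q = refl
indicator-cong (yes p) (no ¬q) P⇔Q = ⊥-elim (¬q (Equivalence.to P⇔Q p))
indicator-cong (no ¬p) (yes q) P⇔Q = ⊥-elim (¬p (Equivalence.from P⇔Q q))
indicator-cong (no ¬p) (no ¬q) P⇔Q = refl

indicator-no : ∀ {P : Set} (P? : Dec P) → ¬ P → indicator P? ≡ 0
indicator-no (yes p) ¬p = ⊥-elim (¬p p)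
indicator-no (no _)  ¬p = refl

indicator-yes : ∀ {P : Set} (P? : Dec P) → P → indicator P? ≡ 1
indicator-yes (yes _) p = refl
indicator-yes (no ¬p) p = ⊥-elim (¬p p)

indicator≤1 : ∀ {P : Set} (P? : Dec P) → indicator P? ≤ 1
indicator≤1 (yes _) = s≤s z≤n
indicator≤1 (no _)  = z≤n

count : ∀ {n} {P : Fin n → Set} → Decidable P → ℕ
count {zero}  P? = 0
count {suc n} P? = indicator (P? zero) + count (P? ∘ suc)

length-filter : ∀ {X : Set} {P : X → Set} (P? : Decidable P) {n} (f : Fin n → X) →
                List.length (List.filter P? (List.tabulate f)) ≡ count (P? ∘ f)
length-filter P? {zero}  f = refl
length-filter P? {suc n} f with P? (f zero)
... | yes _ = cong suc (length-filter P? (f ∘ suc))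
... | no _  = length-filter P? (f ∘ suc)

count-cong : ∀ {n} {P Q : Fin n → Set} (P? : Decidable P) (Q? : Decidable Q) →
             (∀ i → P i ⇔ Q i) → count P? ≡ count Q?
count-cong {zero}  P? Q? P⇔Q = refl
count-cong {suc n} P? Q? P⇔Q =
  cong₂ _+_ (indicator-cong (P? zero) (Q? zero) (P⇔Q zero)) (count-cong (P? ∘ suc) (Q? ∘ suc) (P⇔Q ∘ suc))

count-none : ∀ {n} {P : Fin n → Set} (P? : Decidable P) → (∀ i → ¬ P i) → count P? ≡ 0
count-none {zero}  P? none = refl
count-none {suc n} P? none = cong₂ _+_ (indicator-no (P? zero) (none zero)) (count-none (P? ∘ suc) (none ∘ suc))

-- Used when the end of an interval of positions moves on by one: only the newly covered transition
-- can change the count.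
count-insert : ∀ {n} {P Q : Fin n → Set} (P? : Decidable P) (Q? : Decidable Q) i →
               (∀ k → k ≢ i → P k ⇔ Q k) → ¬ Q i → count P? ≡ indicator (P? i) + count Q?
count-insert P? Q? zero P⇔Q ¬Q = cong (_+_ (indicator (P? zero))) (trans
  (count-cong (P? ∘ suc) (Q? ∘ suc) (λ k → P⇔Q (suc k) λ ()))
  (cong (_+ count (Q? ∘ suc)) (sym (indicator-no (Q? zero) ¬Q))))
count-insert P? Q? (suc i) P⇔Q ¬Q = begin
  indicator (P? zero) + count (P? ∘ suc)
    ≡⟨ cong₂ _+_ (indicator-cong (P? zero) (Q? zero) (P⇔Q zero λ ()))
         (count-insert (P? ∘ suc) (Q? ∘ suc) i (λ k k≢i → P⇔Q (suc k) (k≢i ∘ Fin.suc-injective)) ¬Q) ⟩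
  indicator (Q? zero) + (indicator (P? (suc i)) + count (Q? ∘ suc))
    ≡⟨ ℕ.+-assoc (indicator (Q? zero)) _ _ ⟨
  indicator (Q? zero) + indicator (P? (suc i)) + count (Q? ∘ suc)
    ≡⟨ cong (_+ count (Q? ∘ suc)) (ℕ.+-comm (indicator (Q? zero)) _) ⟩
  indicator (P? (suc i)) + indicator (Q? zero) + count (Q? ∘ suc)
    ≡⟨ ℕ.+-assoc (indicator (P? (suc i))) _ _ ⟩
  indicator (P? (suc i)) + (indicator (Q? zero) + count (Q? ∘ suc)) ∎
  where open ≡-Reasoning

change : ∀ {n} → Fin n → Fin n → ℕ
change p q = indicator (¬? (p Fin.≟ q))

-- The ages after rewriting at `π`, where `d` is 1 or 0 according to whether the control-state
-- changes. The function is total on addresses; its values outside the current tree carry no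
-- meaning.
renew : Node → ℕ → (Node → ℕ) → Node → ℕ
renew π d age η with π ⊑? η
... | yes _ = 0
... | no _  = d + age η

renew-below : ∀ π d age η → renew π d age (π ++ η) ≡ 0
renew-below π d age η with π ⊑? (π ++ η)
... | yes _  = refl
... | no out = ⊥-elim (out (η , refl))

renew-outside : ∀ {π d age η} → ¬ π ⊑ η → renew π d age η ≡ d + age η
renew-outside {π} {η = η} out with π ⊑? η
... | yes p = ⊥-elim (out p)
... | no _  = refl

renew-≤ : ∀ π d age η → renew π d age η ≤ d + age η
renew-≤ π d age η with π ⊑? η
... | yes _ = z≤n
... | no _  = ℕ.≤-refl

-- Birthdates and ages along a run

module _ (G : RbGTRS) where
  open RbGTRS G
  open RankedAlphabet alphabet
  open Configuration

  module _ {n} (run : Run G n) where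
    open Run run

    ChangeBetween : Fin (suc n) → Fin (suc n) → Fin n → Set
    ChangeBetween j i k =
      j Fin.≤ inject₁ k × inject₁ k Fin.< i × ¬ (state (conf (inject₁ k)) ≡ state (conf (suc k)))

    changeBetween? : ∀ j i → Decidable (ChangeBetween j i)
    changeBetween? j i k = j Fin.≤? inject₁ k ×-dec inject₁ k Fin.<? i ×-dec
      ¬? (state (conf (inject₁ k)) Fin.≟ state (conf (suc k)))

    stateChanges-count : ∀ j i → stateChanges G run j i ≡ count (changeBetween? j i)
    stateChanges-count j i = length-filter (changeBetween? j i) id

    stateChanges-refl : ∀ i → stateChanges G run i i ≡ 0
    stateChanges-refl i = trans (stateChanges-count i i)
      (count-none (changeBetween? i i) λ k (i≤k , k<i , _) → ℕ.<⇒≱ k<i i≤k)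

    stateChanges-suc : ∀ {j} i → j Fin.≤ inject₁ i → stateChanges G run j (suc i) ≡
      change (state (conf (inject₁ i))) (state (conf (suc i))) + stateChanges G run j (inject₁ i)
    stateChanges-suc {j} i j≤i = begin
      stateChanges G run j (suc i)
        ≡⟨ stateChanges-count j (suc i) ⟩
      count (changeBetween? j (suc i))
        ≡⟨ count-insert (changeBetween? j (suc i)) (changeBetween? j (inject₁ i)) i
             (λ k k≢i → mk⇔
               (λ (p , q , r) → p , earlier k k≢i q , r)
               (λ (p , q , r) → p , ℕ.<-≤-trans q (ℕ.≤-trans (ℕ.≤-reflexive (Fin.toℕ-inject₁ i)) (ℕ.n≤1+n _)) , r))
             (λ (_ , i<i , _) → ℕ.<-irrefl refl i<i) ⟩
      indicator (changeBetween? j (suc i) i) + count (changeBetween? j (inject₁ i))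
        ≡⟨ cong₂ _+_
             (indicator-cong (changeBetween? j (suc i) i) (¬? (state (conf (inject₁ i)) Fin.≟ state (conf (suc i))))
               (mk⇔ (λ (_ , _ , d) → d) (λ d → j≤i , ℕ.≤-reflexive (cong suc (Fin.toℕ-inject₁ i)) , d)))
             (sym (stateChanges-count j (inject₁ i))) ⟩
      change (state (conf (inject₁ i))) (state (conf (suc i))) + stateChanges G run j (inject₁ i) ∎
      where
      open ≡-Reasoning
      earlier : ∀ k → k ≢ i → inject₁ k Fin.< suc i → inject₁ k Fin.< inject₁ i
      earlier k k≢i q = ℕ.≤∧≢⇒< (ℕ.≤-trans (ℕ.≤-pred q) (ℕ.≤-reflexive (sym (Fin.toℕ-inject₁ i))))
        (λ e → k≢i (Fin.inject₁-injective (Fin.toℕ-injective e)))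

    birthdate-≤ : ∀ {i η j} → Birthdate G run i η j → j Fin.≤ i
    birthdate-≤ (inj₁ (_ , j≤i , _)) = j≤i
    birthdate-≤ (inj₂ (refl , _))    = z≤n

    birthdate-unique : ∀ {i η j j′} → Birthdate G run i η j → Birthdate G run i η j′ → j ≡ j′
    birthdate-unique (inj₁ (w , l , max)) (inj₁ (w′ , l′ , max′)) = Fin.≤-antisym (max′ _ w l) (max _ w′ l′)
    birthdate-unique (inj₁ (w , l , max)) (inj₂ (_ , none)) = ⊥-elim (none _ w l)
    birthdate-unique (inj₂ (_ , none)) (inj₁ (w , l , max)) = ⊥-elim (none _ w l)
    birthdate-unique (inj₂ (refl , _)) (inj₂ (refl , _)) = refl

    ≤suc-inv : ∀ {k : Fin (suc n)} {i : Fin n} → k Fin.≤ suc i → k ≡ suc i ⊎ k Fin.≤ inject₁ i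
    ≤suc-inv {k} {i} k≤ with k Fin.≟ suc i
    ... | yes e = inj₁ e
    ... | no k≢ = inj₂ (subst (toℕ k ≤_) (sym (Fin.toℕ-inject₁ i))
                    (ℕ.≤-pred (ℕ.≤∧≢⇒< k≤ (k≢ ∘ Fin.toℕ-injective))))

    inject₁≤suc : ∀ {k : Fin (suc n)} {i : Fin n} → k Fin.≤ inject₁ i → k Fin.≤ suc i
    inject₁≤suc {i = i} k≤ = ℕ.m≤n⇒m≤1+n (ℕ.≤-trans k≤ (ℕ.≤-reflexive (Fin.toℕ-inject₁ i)))

    birthdate-suc : ∀ {i η j} → ¬ WrittenAt G run (suc i) η →
                    Birthdate G run (inject₁ i) η j → Birthdate G run (suc i) η j
    birthdate-suc ¬w (inj₁ (w , l , max)) = inj₁ (w , inject₁≤suc l , λ k wk k≤ →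
      [ (λ { refl → ⊥-elim (¬w wk) }) , max k wk ]′ (≤suc-inv k≤))
    birthdate-suc {i} ¬w (inj₂ (refl , none)) = inj₂ (refl , λ k wk k≤ →
      [ (λ { refl → ¬w wk }) , none k wk ]′ (≤suc-inv k≤))

    -- The birthdate is carried as a witness, so that no maximum has to be searched for;
    -- `birthdate-unique` identifies it with any other birthdate.
    Exact : Fin (suc n) → (Node → ℕ) → Set
    Exact i age = ∀ {η a} → Labelled (tree (conf i)) η a →
      ∃ λ j → Birthdate G run i η j × stateChanges G run j i ≡ age η

    exact-zero : Exact zero (λ _ → 0)
    exact-zero l = zero , inj₂ (refl , λ { (suc k) w () }) , stateChanges-refl zero

    -- A node below the hole is born at this very step. Any other node was in the previous tree
    -- already and keeps its birthdate, so its age grows by the current state change.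
    exact-suc : ∀ i {z age} → Context.tree (contextAt G run i) ≈ z → Exact (inject₁ i) age →
      Exact (suc i) (renew (path z) (change (state (conf (inject₁ i))) (state (conf (suc i)))) age)
    exact-suc i {z} {age} C≈z exact {η} l with path z ⊑? η
    ... | yes p = suc i ,
          inj₁ (⊑⇒inSubtree {C = contextAt G run i} C≈z p (_ , l) , ℕ.≤-refl , λ k _ k≤ → k≤) ,
          stateChanges-refl (suc i)
    ... | no out =
      let open Transition (proj₂ (step i))
          l₁ = subst (λ t → Labelled t _ _) (trans tree′≡ (≈-substitute C≈z tⁱⁿ)) l
          l₂ = subst (λ t → Labelled t _ _) (sym (trans tree≡ (≈-substitute C≈z tᵒᵘᵗ)))
                 (labelled-outside z out l₁)
          j , b , e = exact l₂
      in j , birthdate-suc (λ w → out (inSubtree⇒⊑ {C = contextAt G run i} C≈z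
               (subst (λ t → InSubtree (contextAt G run i) t η) (trans tree′≡ (≈-substitute C≈z tⁱⁿ)) w))) b ,
         trans (stateChanges-suc i (birthdate-≤ b)) (cong (_+_ _) e)

  -- Steps between configurations with ages, and their translation from and to runs

  Aged : Set
  Aged = Configuration G × (Node → ℕ)

  module _ (ℓ : ℕ) where

    record _↝_ (x y : Aged) : Set where
      field
        {rule}        : Rule alphabet states outputs counters
      open Rule rule
      field
        rule∈         : rule ∈ rules
        source≡       : source ≡ state (proj₁ x)
        target≡       : target ≡ state (proj₁ y)
        guardHolds    : Holds guard (valuation (proj₁ x))
        valuation≡    : valuation (proj₁ y) ≡ zipWith ℤ._+_ (valuation (proj₁ x)) update
        position      : Zipper rank
        {old new}     : Tree rank
        lhsAccepts    : Accepts lhs old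
        rhsAccepts    : Accepts rhs new
        tree≡         : tree (proj₁ x) ≡ plug position old
        tree′≡        : tree (proj₁ y) ≡ plug position new
        young         : ∀ {η a} → Labelled old η a → proj₂ x (path position ++ η) ≤ ℓ
        age≡          : proj₂ y ≡ renew (path position)
                          (change (state (proj₁ x)) (state (proj₁ y))) (proj₂ x)

    module _ {n} (run : Run G n) (restricted : LifespanRestricted G run ℓ) where
      open Run run

      agedStep : ∀ i {age} → Exact run (inject₁ i) age → ∃ λ age′ →
        Exact run (suc i) age′ × (conf (inject₁ i) , age) ↝ (conf (suc i) , age′)
      agedStep i {age} exact =
        let open Transition (proj₂ (step i))
            -- Any tree may fill the irrelevant entries of the zipper; `tᵒᵘᵗ` is one at hand.
            z , C≈z = fromContext tᵒᵘᵗ context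
            t≡ = trans tree≡ (≈-substitute C≈z tᵒᵘᵗ)
        in _ , exact-suc run i C≈z exact , record
             { rule∈ = rule∈ ; source≡ = source≡ ; target≡ = target≡
             ; guardHolds = guardHolds ; valuation≡ = valuation≡
             ; position = z ; lhsAccepts = lhsAccepts ; rhsAccepts = rhsAccepts
             ; tree≡ = t≡ ; tree′≡ = trans tree′≡ (≈-substitute C≈z tⁱⁿ)
             ; young = λ {η} l →
                 let d = _ , subst (λ t → Labelled t (path z ++ η) _) (sym t≡) (labelled-inside z l)
                     j , b , e = exact (proj₂ d)
                 in subst (_≤ ℓ) e (restricted i _
                      (⊑⇒inSubtree {C = context} C≈z (_ , refl) d) j b)
             ; age≡ = refl }

    -- Stated for an arbitrary sequence and predicate because the induction drops the first
    -- position, whereas birthdates and `Exact` refer to the whole run.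
    ageing : ∀ n (conf : Fin (suc n) → Configuration G) (E : Fin (suc n) → (Node → ℕ) → Set) →
      (∀ i {age} → E (inject₁ i) age →
        ∃ λ age′ → E (suc i) age′ × (conf (inject₁ i) , age) ↝ (conf (suc i) , age′)) →
      ∀ {age} → E zero age → ∃ λ age′ → Star _↝_ (conf zero , age) (conf (fromℕ n) , age′)
    ageing zero    conf E next e = _ , ε
    ageing (suc n) conf E next e with next zero e
    ... | _ , e′ , s with ageing n (conf ∘ suc) (E ∘ suc) (next ∘ suc) e′
    ... | _ , p = _ , s ◅ p

    run⇒aged : ∀ {n} (run : Run G n) → LifespanRestricted G run ℓ → let open Run run in
      ∃ λ age → Star _↝_ (conf zero , λ _ → 0) (conf (fromℕ n) , age)
    run⇒aged {n} run restricted =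
      ageing n (Run.conf run) (Exact run) (agedStep run restricted) (exact-zero run)

    length : ∀ {x y} → Star _↝_ x y → ℕ
    length ε       = 0
    length (s ◅ p) = suc (length p)

    at : ∀ {x y} (p : Star _↝_ x y) → Fin (suc (length p)) → Aged
    at {x} p       zero    = x
    at     (s ◅ p) (suc i) = at p i

    at-last : ∀ {x y} (p : Star _↝_ x y) → at p (fromℕ (length p)) ≡ y
    at-last ε       = refl
    at-last (s ◅ p) = at-last p

    stepAt : ∀ {x y} (p : Star _↝_ x y) i → at p (inject₁ i) ↝ at p (suc i)
    stepAt (s ◅ p) zero    = s
    stepAt (s ◅ p) (suc i) = stepAt p i

    valuations : ∀ {x y} → Star _↝_ x y → List (Valuation counters)
    valuations p = List.tabulate (valuation ∘ proj₁ ∘ at p)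

    transition : ∀ {x y} → x ↝ y → ∃[ γ ] Transition G γ (proj₁ x) (proj₁ y)
    transition s = _ , record
      { rule = rule ; rule∈ = rule∈ ; output≡ = refl ; source≡ = source≡ ; target≡ = target≡
      ; guardHolds = guardHolds ; valuation≡ = valuation≡ ; context = toContext position
      ; lhsAccepts = lhsAccepts ; rhsAccepts = rhsAccepts
      ; tree≡ = trans tree≡ (sym (≈-substitute (holed-≈ position) old))
      ; tree′≡ = trans tree′≡ (sym (≈-substitute (holed-≈ position) new)) }
      where open _↝_ s

    module _ {x y} (p : Star _↝_ x y)
             (bounded : ∀ k → ReversalBounded reversals k (valuations p)) where

      toRun : Run G (length p)
      toRun = record
        { conf = proj₁ ∘ at p
        ; step = transition ∘ stepAt p
        ; reversalBounded = bounded }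

      exactAt : proj₂ x ≡ (λ _ → 0) → ∀ i → Exact toRun i (proj₂ (at p i))
      exactAt refl = Fin.<-weakInduction (λ i → Exact toRun i (proj₂ (at p i))) (exact-zero toRun)
        λ i exact → subst (Exact toRun (suc i)) (sym (_↝_.age≡ (stepAt p i)))
          (exact-suc toRun i (holed-≈ (_↝_.position (stepAt p i))) exact)

      toRun-restricted : proj₂ x ≡ (λ _ → 0) → LifespanRestricted G toRun ℓ
      toRun-restricted e i η η∈ j b =
        let open _↝_ (stepAt p i)
            C≈z = holed-≈ position
        in case inSubtree⇒⊑ {C = toContext position} C≈z
             (subst (λ t → InSubtree (toContext position) t η) tree≡ η∈) of λ
             { (η′ , refl) →
               let a , l = proj₁ η∈
                   j′ , b′ , e′ = exactAt e (inject₁ i) l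
               in subst (_≤ ℓ)
                    (trans (sym e′) (cong (λ j → stateChanges G toRun j (inject₁ i)) (birthdate-unique toRun b′ b)))
                    (young {η′} (labelled-below position (subst (λ t → Labelled t (path position ++ η′) a) tree≡ l))) }

    -- Counters that rise and then fall

    Increasing Decreasing : Aged → Aged → Set
    Increasing x y = ∀ k → lookup (valuation (proj₁ x)) k ℤ.≤ lookup (valuation (proj₁ y)) k
    Decreasing x y = ∀ k → lookup (valuation (proj₁ x)) k ℤ.≥ lookup (valuation (proj₁ y)) k

    Up Down : Aged → Aged → Set
    Up   x y = x ↝ y × Increasing x y
    Down x y = x ↝ y × Decreasing x y

    forget : ∀ {R : Aged → Aged → Set} {x y} → Star (λ x y → x ↝ y × R x y) x y → Star _↝_ x y
    forget = Star.map proj₁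

    down-linked : ∀ {x y} (q : Star Down x y) k →
      Linked (λ ν ν′ → lookup ν k ℤ.≥ lookup ν′ k) (valuations (forget q))
    down-linked ε k = Linked.[-]
    down-linked ((s , d) ◅ ε) k = d k Linked.∷ Linked.[-]
    down-linked ((s , d) ◅ q@(_ ◅ _)) k = d k Linked.∷ down-linked q k

    -- The valuation at the turning point `y` is the head of the falling block. The extra lower
    -- bound `ν` in front of the rising block makes the induction uniform, whether or not that block
    -- is empty.
    up-split : ∀ {x y w} (p : Star Up x y) (q : Star Down y w) k → ∃ λ νs →
      valuations (forget p ◅◅ forget q) ≡ νs ++ valuations (forget q) ×
      (∀ {ν} → lookup ν k ℤ.≤ lookup (valuation (proj₁ x)) k →
        Linked (λ ν ν′ → lookup ν k ℤ.≤ lookup ν′ k) (ν ∷ νs))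
    up-split ε q k = [] , refl , λ _ → Linked.[-]
    up-split {x} ((s , u) ◅ p) q k with up-split p q k
    ... | νs , e , linked = _ ∷ νs , cong (_ ∷_) e , λ le → le Linked.∷ linked {valuation (proj₁ x)} (u k)

    up-down-bounded : ∀ {x y w} (p : Star Up x y) (q : Star Down y w) k →
      ReversalBounded 1 k (valuations (forget p ◅◅ forget q))
    up-down-bounded {x} p q k with up-split p q k
    ... | νs , e , linked = νs ∷ valuations (forget q) ∷ [] ,
      trans e (cong (νs ++_) (sym (List.++-identityʳ _))) ,
      inj₁ (Linked.tail (linked {valuation (proj₁ x)} ℤ.≤-refl)) Vec.∷ inj₂ (down-linked q k) Vec.∷ Vec.[]

    aged⇒run : reversals ≡ 1 → ∀ {c y d age} (p : Star Up (c , λ _ → 0) y) (q : Star Down y (d , age)) →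
      ∃[ n ] Σ[ run ∈ Run G n ]
        Run.conf run zero ≡ c × Run.conf run (fromℕ n) ≡ d × LifespanRestricted G run ℓ
    aged⇒run refl p q =
      _ , toRun path-◅◅ (up-down-bounded p q) , refl , cong proj₁ (at-last path-◅◅) ,
      toRun-restricted path-◅◅ (up-down-bounded p q) refl
      where path-◅◅ = forget p ◅◅ forget q

-- Flat trees, and the alphabet of the reduction

-- The rank of a leaf symbol is `lookup (replicate n 0) i`, which does not reduce to 0 for variable
-- `i`; this plays the part of the empty vector.
noChildren : ∀ {X : Set} {n} (i : Fin n) → Vec X (lookup (replicate n 0) i)
noChildren zero    = []
noChildren (suc i) = noChildren i

noChildren-unique : ∀ {X : Set} {n} (i : Fin n) (xs : Vec X (lookup (replicate n 0) i)) → xs ≡ noChildren i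
noChildren-unique zero    [] = refl
noChildren-unique (suc i) xs = noChildren-unique i xs

noChild : ∀ {n} (i : Fin n) → ¬ Fin (lookup (replicate n 0) i)
noChild (suc i) k = noChild i k

-- a and c build the initial chain c(a(…a(x)…)), and f grows the tree; the
-- leaf with index 0 is the place x for growth, and each of the leaves with
-- index r + 1 is a unit stored in register r.
alphabet : ℕ → RankedAlphabet
alphabet m = record { size = 3 + m ; ranks = 1 ∷ 1 ∷ 2 ∷ replicate m 0 }

pattern a-sym      = zero
pattern c-sym      = suc zero
pattern f-sym      = suc (suc zero)
pattern leaf-sym i = suc (suc (suc i))

module _ {m : ℕ} where
  open RankedAlphabet (alphabet m)

  leaf : Fin m → Tree rank
  leaf i = node (leaf-sym i) (noChildren i)

  leaf-unique : ∀ i ts → node (leaf-sym i) ts ≡ leaf i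
  leaf-unique i ts = cong (node (leaf-sym i)) (noChildren-unique i ts)

  Flat : Set
  Flat = Σ[ s ∈ Symbol ] Vec (Fin m) (rank s)

  flat : Flat → Tree rank
  flat (s , is) = node s (tabulate λ k → leaf (lookup is k))

  -- Every rule of the reduction rewrites one fixed flat tree into another, so automata for single
  -- trees suffice. State `zero` belongs to the root and `suc k` to its child `k`.
  flatNTA : Flat → NTA (alphabet m)
  flatNTA (s , is) = record
    { states      = suc (rank s)
    ; transitions = (s , tabulate suc , zero) ∷
                    List.tabulate (λ k → leaf-sym (lookup is k) , noChildren (lookup is k) , suc k)
    ; final       = inside ∷ ∅ }

  flat-accepts : ∀ p → Accepts (flatNTA p) (flat p)
  flat-accepts p@(s , is) = zero , here , apply (here refl) (Pointwise.tabulate⁺ λ k →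
    apply (there (∈-tabulate⁺ {f = λ k → leaf-sym (lookup is k) , noChildren (lookup is k) , suc k} k))
      (none (lookup is k)))
    where
    none : ∀ {n X Y} {R : X → Y → Set} (i : Fin n) → Pointwise R (noChildren i) (noChildren i)
    none zero    = Pointwise.[]
    none (suc i) = none i

  accepts-flat : ∀ p {t} → Accepts (flatNTA p) t → t ≡ flat p
  accepts-flat (s , is) (suc q , there q∈ , _) = ⊥-elim (∉⊥ q∈)
  accepts-flat p@(s , is) (zero , here , apply {ts = ts} (here refl) ps) =
    cong (node s) (vec-ext λ k → trans
      (child-leaf k (subst (λ q → _⇒_ (flatNTA p) (lookup ts k) q) (Vec.lookup∘tabulate suc k) (Pointwise.lookup ps k)))
      (sym (Vec.lookup∘tabulate _ k)))
    where
    child-leaf : ∀ k {t} → _⇒_ (flatNTA p) t (suc k) → t ≡ leaf (lookup is k)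
    child-leaf k (apply (there t∈) ps) with ∈-tabulate⁻ t∈
    ... | _ , refl = leaf-unique _ _
  accepts-flat (s , is) (zero , here , apply (there t∈) ps) with ∈-tabulate⁻ t∈
  ... | _ , ()

  leafᶠ : Fin m → Flat
  leafᶠ i = leaf-sym i , noChildren i

  flat-leaf : ∀ i → flat (leafᶠ i) ≡ leaf i
  flat-leaf i = leaf-unique i _

-- Additive weights of trees, and numbers of units

module _ {A : Set} {ρ : A → ℕ} (w : A → ℕ) where
  mutual
    weight : Tree ρ → ℕ
    weight (node a ts) = w a + weights ts

    weights : ∀ {n} → Vec (Tree ρ) n → ℕ
    weights []       = 0
    weights (t ∷ ts) = weight t + weights ts

  weights-update : ∀ {n} (ts : Vec (Tree ρ) n) i → ∃ λ k → ∀ t → weights (ts [ i ]≔ t) ≡ k + weight t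
  weights-update (t ∷ ts) zero = weights ts , λ t → ℕ.+-comm (weight t) _
  weights-update (t ∷ ts) (suc i) with weights-update ts i
  ... | k , e = weight t + k , λ t′ → trans (cong (_+_ (weight t)) (e t′)) (sym (ℕ.+-assoc (weight t) k _))

  weight-plug : ∀ z → ∃ λ k → ∀ s → weight (plug z s) ≡ k + weight s
  weight-plug hole = 0 , λ s → refl
  weight-plug (down a i ts z) with weights-update ts i | weight-plug z
  ... | j , e | k , e′ = w a + (j + k) , λ s → trans (cong (_+_ (w a))
    (trans (e (plug z s)) (trans (cong (_+_ j) (e′ s)) (sym (ℕ.+-assoc j k _)))))
    (sym (ℕ.+-assoc (w a) _ _))

  mutual
    weight-pos : ∀ {k} t → weight t ≡ suc k → ∃₂ λ η a → Labelled t η a × w a ≢ 0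
    weight-pos (node a ts) e with w a in e′
    ... | suc _ = [] , a , root , λ e″ → ℕ.1+n≢0 (trans (sym e′) e″)
    ... | zero with weights-pos ts e
    ... | i , η , b , l , pos = suc (toℕ i) ∷ η , b , child i l , pos

    weights-pos : ∀ {k n} (ts : Vec (Tree ρ) n) → weights ts ≡ suc k →
                  ∃ λ i → ∃₂ λ η a → Labelled (lookup ts i) η a × w a ≢ 0
    weights-pos (t ∷ ts) e with weight t in e′
    weights-pos (t ∷ ts) e | suc _ with weight-pos t e′
    ... | η , a , l , pos = zero , η , a , l , pos
    weights-pos (t ∷ ts) e | zero with weights-pos ts e
    ... | i , η , b , l , pos = suc i , η , b , l , pos

  weight-labelled : ∀ {t : Tree ρ} {η a} → Labelled t η a → w a ≤ weight t
  weight-labelled root = ℕ.m≤m+n _ _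
  weight-labelled (child {a} {ts} i l) = ℕ.≤-trans (weight-labelled l) (ℕ.≤-trans (lookup≤ ts i) (ℕ.m≤n+m _ _))
    where
    lookup≤ : ∀ {n} (ts : Vec (Tree ρ) n) i → weight (lookup ts i) ≤ weights ts
    lookup≤ (t ∷ ts) zero    = ℕ.m≤m+n _ _
    lookup≤ (t ∷ ts) (suc i) = ℕ.≤-trans (lookup≤ ts i) (ℕ.m≤n+m _ _)

module _ {R : ℕ} where
  open RankedAlphabet (alphabet (suc R))

  onRegisters : (Fin R → ℕ) → Symbol → ℕ
  onRegisters w (leaf-sym (suc r)) = w r
  onRegisters w _                  = 0

  units : (Fin R → ℕ) → Tree rank → ℕ
  units w = weight (onRegisters w)

  stored : Fin R → Tree rank → ℕ
  stored r = units (λ r′ → indicator (r Fin.≟ r′))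

  total : Tree rank → ℕ
  total = units (λ _ → 1)

  -- The place for growth is written anew next to the unit, so that growth can continue and the
  -- place is fresh again.
  growᶠ : Fin R → Flat
  growᶠ r = f-sym , zero ∷ suc r ∷ []

  unwrapᵃ unwrapᶜ : Flat {suc R}
  unwrapᵃ = a-sym , zero ∷ []
  unwrapᶜ = c-sym , zero ∷ []

  weights-noChildren : ∀ {n} w (i : Fin n) → weights {ρ = rank} w (noChildren i) ≡ 0
  weights-noChildren w zero    = refl
  weights-noChildren w (suc i) = weights-noChildren w i

  units-leaf : ∀ w i → units w (leaf i) ≡ onRegisters w (leaf-sym i)
  units-leaf w i = trans (cong (_+_ (onRegisters w (leaf-sym i)))
    (weights-noChildren (onRegisters w) i)) (ℕ.+-identityʳ _)

  units-flat-leaf : ∀ w i → units w (flat (leafᶠ i)) ≡ onRegisters w (leaf-sym i)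
  units-flat-leaf w i = trans (cong (units w) (flat-leaf i)) (units-leaf w i)

  units-grow : ∀ w r → units w (flat (growᶠ r)) ≡ w r
  units-grow w r = trans (cong₂ _+_ (units-leaf w zero) (cong (_+ 0) (units-leaf w (suc r)))) (ℕ.+-identityʳ _)

-- Chains, and where the initial rules can match in them

module _ {R : ℕ} where
  open RankedAlphabet (alphabet (suc R))

  tower : ℕ → Tree rank
  tower zero    = leaf zero
  tower (suc k) = node a-sym (tower k ∷ [])

  chain : ℕ → Tree rank
  chain k = node c-sym (tower k ∷ [])

  label : Tree rank → Symbol
  label (node a _) = a

  -- Serves to strip the root from both sides of an equation between trees.
  only : Tree rank → Tree rank
  only (node a-sym (t ∷ [])) = t
  only (node c-sym (t ∷ [])) = t
  only t                     = t

  units-tower : ∀ w k → units {R} w (tower k) ≡ 0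
  units-tower w zero    = refl
  units-tower w (suc k) = trans (ℕ.+-identityʳ _) (units-tower w k)

  units-chain : ∀ w k → units {R} w (chain k) ≡ 0
  units-chain w k = trans (ℕ.+-identityʳ _) (units-tower w k)

  plug-tower : ∀ z k → plug z (flat (unwrapᵃ {R})) ≡ tower k →
               ∃ λ k′ → k ≡ suc k′ × plug z (leaf zero) ≡ tower k′
  plug-tower hole zero e with () ← cong label e
  plug-tower hole (suc zero) e = zero , refl , refl
  plug-tower hole (suc (suc k)) e with () ← cong (label ∘ only) e
  plug-tower (down a-sym zero (t ∷ []) z) zero e with () ← cong label e
  plug-tower (down a-sym zero (t ∷ []) z) (suc k) e with plug-tower z k (cong only e)
  ... | k′ , refl , e′ = suc k′ , refl , cong (λ t → node a-sym (t ∷ [])) e′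
  plug-tower (down c-sym i ts z) zero e with () ← cong label e
  plug-tower (down c-sym i ts z) (suc k) e with () ← cong label e
  plug-tower (down f-sym i ts z) zero e with () ← cong label e
  plug-tower (down f-sym i ts z) (suc k) e with () ← cong label e
  plug-tower (down (leaf-sym j) i ts z) k e = ⊥-elim (noChild j i)

  plug-c-tower : ∀ z k → plug z (flat (unwrapᶜ {R})) ≢ tower k
  plug-c-tower hole zero e with () ← cong label e
  plug-c-tower hole (suc k) e with () ← cong label e
  plug-c-tower (down a-sym zero (t ∷ []) z) zero e with () ← cong label e
  plug-c-tower (down a-sym zero (t ∷ []) z) (suc k) e = plug-c-tower z k (cong only e)
  plug-c-tower (down c-sym i ts z) zero e with () ← cong label e
  plug-c-tower (down c-sym i ts z) (suc k) e with () ← cong label e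
  plug-c-tower (down f-sym i ts z) zero e with () ← cong label e
  plug-c-tower (down f-sym i ts z) (suc k) e with () ← cong label e
  plug-c-tower (down (leaf-sym j) i ts z) k e = noChild j i

  unload-chain : ∀ z k → plug z (flat (unwrapᵃ {R})) ≡ chain k →
                 ∃ λ k′ → k ≡ suc k′ × plug z (leaf zero) ≡ chain k′
  unload-chain hole k e with () ← cong label e
  unload-chain (down a-sym i ts z) k e with () ← cong label e
  unload-chain (down c-sym zero (t ∷ []) z) k e with plug-tower z k (cong only e)
  ... | k′ , refl , e′ = k′ , refl , cong (λ t → node c-sym (t ∷ [])) e′
  unload-chain (down f-sym i ts z) k e with () ← cong label e
  unload-chain (down (leaf-sym j) i ts z) k e = ⊥-elim (noChild j i)

  -- The symbol `c` labels the root of a chain and nothing else. Hence the initial phase can be left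
  -- only after every `a` has been removed, when the whole input has been measured.
  enter-chain : ∀ z k → plug z (flat (unwrapᶜ {R})) ≡ chain k → z ≡ hole × k ≡ 0
  enter-chain hole zero e = refl , refl
  enter-chain hole (suc k) e with () ← cong (label ∘ only) e
  enter-chain (down a-sym i ts z) k e with () ← cong label e
  enter-chain (down c-sym zero (t ∷ []) z) k e = ⊥-elim (plug-c-tower z k (cong only e))
  enter-chain (down f-sym i ts z) k e with () ← cong label e
  enter-chain (down (leaf-sym j) i ts z) k e = ⊥-elim (noChild j i)

  labelled-leaf : ∀ {i η b} → Labelled (flat (leafᶠ {suc R} i)) η b → η ≡ [] × b ≡ leaf-sym i
  labelled-leaf root = refl , refl
  labelled-leaf {i} (child k l) = ⊥-elim (noChild i k)

  stored-labelled : ∀ {r k} t → stored {R} r t ≡ suc k → ∃ λ η → Labelled t η (leaf-sym (suc r))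
  stored-labelled {r} t e with weight-pos (onRegisters (λ r′ → indicator (r Fin.≟ r′))) t e
  ... | η , leaf-sym (suc r′) , l , pos with r Fin.≟ r′
  ... | yes refl = η , l
  ... | no _     = ⊥-elim (pos refl)
  stored-labelled t e | η , a-sym , l , pos = ⊥-elim (pos refl)
  stored-labelled t e | η , c-sym , l , pos = ⊥-elim (pos refl)
  stored-labelled t e | η , f-sym , l , pos = ⊥-elim (pos refl)
  stored-labelled t e | η , leaf-sym zero , l , pos = ⊥-elim (pos refl)

  units-moved : ∀ w z {p p′ : Flat {suc R}} {a b} → units w (flat p) ≡ a → units w (flat p′) ≡ b →
                ∃ λ k → units w (plug z (flat p)) ≡ k + a × units w (plug z (flat p′)) ≡ k + b
  units-moved w z refl refl = let k , e = weight-plug (onRegisters w) z in k , e _ , e _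

module _ {A : Set} {ρ : A → ℕ} where
  mutual
    -- Used to visit the leaves one after another when they are refreshed.
    nodes : (t : Tree ρ) → List (∃₂ λ η a → Labelled t η a)
    nodes (node a ts) = ([] , a , root) ∷
      List.map (λ (i , η , b , l) → suc (toℕ i) ∷ η , b , child i l) (forest ts)

    forest : ∀ {n} (ts : Vec (Tree ρ) n) → List (∃ λ i → ∃₂ λ η a → Labelled (lookup ts i) η a)
    forest []       = []
    forest (t ∷ ts) = List.map (zero ,_) (nodes t) ++ List.map (λ (i , l) → suc i , l) (forest ts)

  mutual
    ∈-nodes : ∀ (t : Tree ρ) {η a} (l : Labelled t η a) → (η , a , l) ∈ nodes t
    ∈-nodes (node a ts) root        = here refl
    ∈-nodes (node a ts) (child i l) = there (∈-map⁺ _ (∈-forest ts i l))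

    ∈-forest : ∀ {n} (ts : Vec (Tree ρ) n) i {η a} (l : Labelled (lookup ts i) η a) → (i , η , a , l) ∈ forest ts
    ∈-forest (t ∷ ts) zero    l = ∈-++⁺ˡ (∈-map⁺ (zero ,_) (∈-nodes t l))
    ∈-forest (t ∷ ts) (suc i) l = ∈-++⁺ʳ (List.map (zero ,_) (nodes t))
      (∈-map⁺ (λ (i , l) → suc i , l) (∈-forest ts i l))

-- The reduction from register machines

module Reduction (N : Machine) where
  open Machine N
  open RankedAlphabet (alphabet (suc registers)) public

  data State : Set where
    start′ final load : State
    main test         : Fin labels → State

  -- `start′` and `final` receive the numbers 0 and 1 whatever `N` is, so that these components of
  -- the code of an instance are constants.
  encode : State → Fin (3 + (labels + labels))
  encode start′   = zero
  encode final    = suc zero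
  encode load     = suc (suc zero)
  encode (main q) = suc (suc (suc (q ↑ˡ labels)))
  encode (test q) = suc (suc (suc (labels ↑ʳ q)))

  decode : Fin (3 + (labels + labels)) → State
  decode zero          = start′
  decode (suc zero)    = final
  decode (suc (suc zero)) = load
  decode (suc (suc (suc i))) with splitAt labels i
  ... | inj₁ q = main q
  ... | inj₂ q = test q

  decode-encode : ∀ s → decode (encode s) ≡ s
  decode-encode start′   = refl
  decode-encode final    = refl
  decode-encode load     = refl
  decode-encode (main q) rewrite Fin.splitAt-↑ˡ labels q labels = refl
  decode-encode (test q) rewrite Fin.splitAt-↑ʳ labels labels q = refl

  encode-injective : ∀ {s s′} → encode s ≡ encode s′ → s ≡ s′
  encode-injective {s} {s′} e = trans (sym (decode-encode s)) (trans (cong decode e) (decode-encode s′))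

  record Spec : Set where
    constructor spec
    field
      from    : State
      old new : Flat {suc registers}
      to      : State
      guard   : Constraint 3
      update  : Vec ℤ 3

  toRule : Spec → Rule (alphabet (suc registers)) (3 + (labels + labels)) 1 3
  toRule (spec from old new to guard update) = record
    { source = encode from ; target = encode to ; lhs = flatNTA old ; rhs = flatNTA new
    ; guard = guard ; output = zero ; update = update }

  x : Flat {suc registers}
  x = leafᶠ zero

  unit : Fin registers → Flat {suc registers}
  unit r = leafᶠ (suc r)

  allZero : Constraint 3
  allZero = and (atom zero eq 0ℤ) (and (atom (suc zero) eq 0ℤ) (atom (suc (suc zero)) eq 0ℤ))

  -- The counters hold, once load is reached, the number of units still to be
  -- created by the machine, to be removed, and to be created from the input.
  keep : Vec ℤ 3
  keep = 0ℤ ∷ 0ℤ ∷ 0ℤ ∷ []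

  -- The inductive form of the list `specs`, for proofs by cases on the rule applied.
  data Allowed : Spec → Set where
    -- A unit once created must also be removed, so each guessed creation raises both counters; for
    -- the same reason `unload` raises the second counter along with the third.
    pump    : Allowed (spec start′ x x start′ tt (1ℤ ∷ 1ℤ ∷ 0ℤ ∷ []))
    unload  : Allowed (spec start′ unwrapᵃ x start′ tt (0ℤ ∷ 1ℤ ∷ 1ℤ ∷ []))
    enter   : Allowed (spec start′ unwrapᶜ x load tt keep)
    fetch   : Allowed (spec load x (growᶠ zero) load tt (0ℤ ∷ 0ℤ ∷ -1ℤ ∷ []))
    go      : Allowed (spec load x x (main start) tt keep)
    refresh : ∀ q i → Allowed (spec (main q) (leafᶠ i) (leafᶠ i) (main q) tt keep)
    create  : ∀ {q r l} → lookup program q ≡ inc r l →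
              Allowed (spec (main q) x (growᶠ r) (main l) tt (-1ℤ ∷ 0ℤ ∷ 0ℤ ∷ []))
    remove  : ∀ {q r l l′} → lookup program q ≡ dec r l l′ →
              Allowed (spec (main q) (unit r) x (main l) tt (0ℤ ∷ -1ℤ ∷ 0ℤ ∷ []))
    try     : ∀ {q r l l′} → lookup program q ≡ dec r l l′ →
              Allowed (spec (main q) x x (test q) tt keep)
    retain  : ∀ {q r l l′} → lookup program q ≡ dec r l l′ → ∀ i → i ≢ suc r →
              Allowed (spec (test q) (leafᶠ i) (leafᶠ i) (test q) tt keep)
    pass    : ∀ {q r l l′} → lookup program q ≡ dec r l l′ →
              Allowed (spec (test q) x x (main l′) tt keep)
    drain   : ∀ {q} → lookup program q ≡ halt true → ∀ r →
              Allowed (spec (main q) (unit r) x (main q) tt (0ℤ ∷ -1ℤ ∷ 0ℤ ∷ []))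
    finish  : ∀ {q} → lookup program q ≡ halt true →
              Allowed (spec (main q) x x final allZero keep)

  refreshSpec retainSpec : Fin labels → Fin (suc registers) → Spec
  refreshSpec q i = spec (main q) (leafᶠ i) (leafᶠ i) (main q) tt keep
  retainSpec  q i = spec (test q) (leafᶠ i) (leafᶠ i) (test q) tt keep

  drainSpec : Fin labels → Fin registers → Spec
  drainSpec q r = spec (main q) (unit r) x (main q) tt (0ℤ ∷ -1ℤ ∷ 0ℤ ∷ [])

  specsFor : Fin labels → Instruction labels registers → List Spec
  specsFor q (inc r l)    = spec (main q) x (growᶠ r) (main l) tt (-1ℤ ∷ 0ℤ ∷ 0ℤ ∷ []) ∷ []
  specsFor q (dec r l l′) =
    spec (main q) (unit r) x (main l) tt (0ℤ ∷ -1ℤ ∷ 0ℤ ∷ []) ∷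
    spec (main q) x x (test q) tt keep ∷
    spec (test q) x x (main l′) tt keep ∷
    List.tabulate (retainSpec q ∘ punchIn (suc r))
  specsFor q (halt true)  = spec (main q) x x final allZero keep ∷ List.tabulate (drainSpec q)
  specsFor q (halt false) = []

  specsAt : Fin labels → List Spec
  specsAt q = List.tabulate (refreshSpec q) ++ specsFor q (lookup program q)

  specs : List Spec
  specs =
    spec start′ x x start′ tt (1ℤ ∷ 1ℤ ∷ 0ℤ ∷ []) ∷
    spec start′ unwrapᵃ x start′ tt (0ℤ ∷ 1ℤ ∷ 1ℤ ∷ []) ∷
    spec start′ unwrapᶜ x load tt keep ∷
    spec load x (growᶠ zero) load tt (0ℤ ∷ 0ℤ ∷ -1ℤ ∷ []) ∷
    spec load x x (main start) tt keep ∷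
    List.concatMap specsAt (List.allFin labels)

  specsFor⇒allowed : ∀ {q} ins {σ} → lookup program q ≡ ins → σ ∈ specsFor q ins → Allowed σ
  specsFor⇒allowed (inc r l)    e (here refl)                 = create e
  specsFor⇒allowed (dec r l l′) e (here refl)                 = remove e
  specsFor⇒allowed (dec r l l′) e (there (here refl))         = try e
  specsFor⇒allowed (dec r l l′) e (there (there (here refl))) = pass e
  specsFor⇒allowed {q} (dec r l l′) e (there (there (there m)))
    with j , refl ← ∈-tabulate⁻ {f = retainSpec q ∘ punchIn (suc r)} m =
    retain e _ (Fin.punchInᵢ≢i (suc r) j)
  specsFor⇒allowed (halt true) e (here refl) = finish e
  specsFor⇒allowed {q} (halt true) e (there m)
    with r , refl ← ∈-tabulate⁻ {f = drainSpec q} m = drain e r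

  specsAt⇒allowed : ∀ {q σ} → σ ∈ specsAt q → Allowed σ
  specsAt⇒allowed {q} m with ∈-++⁻ (List.tabulate (refreshSpec q)) m
  ... | inj₁ m′ with i , refl ← ∈-tabulate⁻ {f = refreshSpec q} m′ = refresh q i
  ... | inj₂ m′ = specsFor⇒allowed _ refl m′

  ∈⇒allowed : ∀ {σ} → σ ∈ specs → Allowed σ
  ∈⇒allowed (here refl)                                 = pump
  ∈⇒allowed (there (here refl))                         = unload
  ∈⇒allowed (there (there (here refl)))                 = enter
  ∈⇒allowed (there (there (there (here refl))))         = fetch
  ∈⇒allowed (there (there (there (there (here refl))))) = go
  ∈⇒allowed (there (there (there (there (there m)))))
    with _ , m′ , m″ ← ∈-concat⁻′ (List.map specsAt (List.allFin labels)) m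
    with q , _ , refl ← ∈-map⁻ specsAt m″ = specsAt⇒allowed m′

  specsAt⇒∈ : ∀ q {σ} → σ ∈ specsAt q → σ ∈ specs
  specsAt⇒∈ q m = there (there (there (there (there
    (∈-concat⁺′ m (∈-map⁺ specsAt (∈-allFin q)))))))

  specsFor⇒∈ : ∀ {q ins σ} → lookup program q ≡ ins → σ ∈ specsFor q ins → σ ∈ specs
  specsFor⇒∈ {q} refl m = specsAt⇒∈ q (∈-++⁺ʳ _ m)

  allowed⇒∈ : ∀ {σ} → Allowed σ → σ ∈ specs
  allowed⇒∈ pump          = here refl
  allowed⇒∈ unload        = there (here refl)
  allowed⇒∈ enter         = there (there (here refl))
  allowed⇒∈ fetch         = there (there (there (here refl)))
  allowed⇒∈ go            = there (there (there (there (here refl))))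
  allowed⇒∈ (refresh q i) = specsAt⇒∈ q (∈-++⁺ˡ (∈-tabulate⁺ {f = refreshSpec q} i))
  allowed⇒∈ (create e)    = specsFor⇒∈ e (here refl)
  allowed⇒∈ (remove e)    = specsFor⇒∈ e (here refl)
  allowed⇒∈ (try e)       = specsFor⇒∈ e (there (here refl))
  allowed⇒∈ (pass e)      = specsFor⇒∈ e (there (there (here refl)))
  allowed⇒∈ (retain {q} {r} e i i≢) = specsFor⇒∈ e (there (there (there
    (subst (λ i → retainSpec q i ∈ _) (Fin.punchIn-punchOut (i≢ ∘ sym))
      (∈-tabulate⁺ {f = retainSpec q ∘ punchIn (suc r)} (punchOut (i≢ ∘ sym)))))))
  allowed⇒∈ (drain {q} e r) = specsFor⇒∈ e (there (∈-tabulate⁺ {f = drainSpec q} r))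
  allowed⇒∈ (finish e)    = specsFor⇒∈ e (here refl)

  system : RbGTRS
  system = record
    { states = 3 + (labels + labels) ; alphabet = alphabet (suc registers)
    ; outputs = 1 ; counters = 3 ; rules = List.map toRule specs ; reversals = 1 }

  open Configuration

  change-same : ∀ s → change (encode s) (encode s) ≡ 0
  change-same s = indicator-no (¬? (encode s Fin.≟ encode s)) (λ ne → ne refl)

  change-differ : ∀ {s s′} → s ≢ s′ → change (encode s) (encode s′) ≡ 1
  change-differ {s} {s′} ne = indicator-yes (¬? (encode s Fin.≟ encode s′)) (ne ∘ encode-injective)

  -- Steps as replacements of one flat tree by another

  record Move (σ : Spec) (x y : Aged system) : Set where
    open Spec σ
    field
      from≡      : encode from ≡ state (proj₁ x)
      to≡        : encode to ≡ state (proj₁ y)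
      guardHolds : Holds guard (valuation (proj₁ x))
      valuation≡ : valuation (proj₁ y) ≡ zipWith ℤ._+_ (valuation (proj₁ x)) update
      position   : Zipper rank
      tree≡      : tree (proj₁ x) ≡ plug position (flat old)
      tree′≡     : tree (proj₁ y) ≡ plug position (flat new)
      young      : ∀ {η a} → Labelled (flat old) η a → proj₂ x (path position ++ η) ≤ 1
      age≡       : proj₂ y ≡ renew (path position) (change (encode from) (encode to)) (proj₂ x)

  infix 4 _⟿_
  _⟿_ : Aged system → Aged system → Set
  _⟿_ = _↝_ system 1

  move⇒step : ∀ {σ x y} → Allowed σ → Move σ x y → x ⟿ y
  move⇒step {σ} allowed record
    { from≡ = refl ; to≡ = refl ; guardHolds = g ; valuation≡ = v
    ; position = z ; tree≡ = t ; tree′≡ = t′ ; young = y ; age≡ = a } = record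
    { rule = toRule σ ; rule∈ = ∈-map⁺ toRule {xs = specs} (allowed⇒∈ allowed) ; source≡ = refl ; target≡ = refl
    ; guardHolds = g ; valuation≡ = v ; position = z
    ; lhsAccepts = flat-accepts (Spec.old σ) ; rhsAccepts = flat-accepts (Spec.new σ)
    ; tree≡ = t ; tree′≡ = t′ ; young = y ; age≡ = a }

  step⇒move : ∀ {x y} → x ⟿ y → ∃ λ σ → Allowed σ × Move σ x y
  step⇒move record { rule∈ = rule∈ ; source≡ = s ; target≡ = s′
    ; guardHolds = g ; valuation≡ = v ; position = z
    ; lhsAccepts = old ; rhsAccepts = new
    ; tree≡ = t ; tree′≡ = t′ ; young = y ; age≡ = a }
    with σ , σ∈ , refl ← ∈-map⁻ toRule {xs = specs} rule∈
    with refl ← s | refl ← s′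
    with refl ← accepts-flat (Spec.old σ) old | refl ← accepts-flat (Spec.new σ) new =
    σ , ∈⇒allowed σ∈ , record
    { from≡ = refl ; to≡ = refl ; guardHolds = g ; valuation≡ = v
    ; position = z ; tree≡ = t ; tree′≡ = t′ ; young = y ; age≡ = a }

  -- Soundness: from runs to accepting computations

  Halts : Fin labels → Vec ℕ registers → Set
  Halts q v = ∃₂ λ l w → Star (_⟶_ N) (q , v) (l , w) × lookup program l ≡ halt true

  record Matches (v : Vec ℕ registers) (t : Tree rank) : Set where
    constructor matching
    field match : ∀ r → lookup v r ≡ stored r t
  open Matches public

  input : Vec ℤ 3 → ℤ
  input ν = lookup ν (suc (suc zero))

  -- What the rest of a run to `final` ensures about its first configuration. In `start′` the input
  -- is the remaining chain plus the amount measured; in `load` it is the units fetched plus the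
  -- amount left. In `test` the units of the tested register must have age 0, because the coming
  -- state change makes them older by one and no unit may exceed age 1.
  Simulated : State → Configuration system → (Node → ℕ) → Set
  Simulated start′   ⟪ _ , t , ν ⟫ age = ∀ {k n} → t ≡ chain k →
    + n ≡ + k ℤ.+ input ν → Halts start (n ∷ replicate others 0)
  Simulated final    ⟪ _ , t , ν ⟫ age = ⊤
  Simulated load     ⟪ _ , t , ν ⟫ age = ∀ {n v} → + n ≡ + stored zero t ℤ.+ input ν →
    (∀ r → lookup v r ≡ stored (suc r) t) → Halts start (n ∷ v)
  Simulated (main q) ⟪ _ , t , ν ⟫ age = input ν ≡ 0ℤ × (∀ {v} → Matches v t → Halts q v)
  Simulated (test q) ⟪ _ , t , ν ⟫ age = input ν ≡ 0ℤ ×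
    (∀ {r l l′} → lookup program q ≡ dec r l l′ →
      (∀ {η} → Labelled t η (leaf-sym (suc r)) → age η ≤ 0) ×
      (∀ {v} → Matches v t → Halts l′ v))

  Good : State → Configuration system → (Node → ℕ) → Set
  Good s c age = (∀ {η r} → Labelled (tree c) η (leaf-sym (suc r)) → age η ≤ 1) × Simulated s c age

  -- The removals outstanding equal the creations outstanding, by the machine and from the input,
  -- plus the units present. With all counters zero this leaves no unit.
  Balanced : Configuration system → Set
  Balanced ⟪ _ , t , ν ⟫ =
    lookup ν (suc zero) ≡ lookup ν zero ℤ.+ lookup ν (suc (suc zero)) ℤ.+ + total t

  update-balanced : ∀ {σ} → Allowed σ → let open Spec σ in
    lookup update (suc zero) ℤ.+ + total (flat old) ≡
    lookup update zero ℤ.+ lookup update (suc (suc zero)) ℤ.+ + total (flat new)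
  update-balanced pump            = refl
  update-balanced unload          = refl
  update-balanced enter           = refl
  update-balanced fetch           = refl
  update-balanced go              = refl
  update-balanced (refresh q i)   = refl
  update-balanced (create {r = r} e) = sym (cong (λ n → -1ℤ ℤ.+ + n) (units-grow (λ _ → 1) r))
  update-balanced (remove {r = r} e) = cong (λ n → -1ℤ ℤ.+ + n) (units-flat-leaf (λ _ → 1) (suc r))
  update-balanced (try e)         = refl
  update-balanced (retain e i i≢) = refl
  update-balanced (pass e)        = refl
  update-balanced (drain e r)     = cong (λ n → -1ℤ ℤ.+ + n) (units-flat-leaf (λ _ → 1) (suc r))
  update-balanced (finish e)      = refl

  balance-arithmetic : ∀ {α β γ k o n u₁ u₂ u₃} → β ≡ α ℤ.+ γ ℤ.+ (k ℤ.+ o) →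
    u₂ ℤ.+ o ≡ u₁ ℤ.+ u₃ ℤ.+ n → β ℤ.+ u₂ ≡ (α ℤ.+ u₁) ℤ.+ (γ ℤ.+ u₃) ℤ.+ (k ℤ.+ n)
  balance-arithmetic {α} {β} {γ} {k} {o} {n} {u₁} {u₂} {u₃} refl e = begin
    (α ℤ.+ γ ℤ.+ (k ℤ.+ o)) ℤ.+ u₂        ≡⟨ left α γ k o u₂ ⟩
    (α ℤ.+ γ ℤ.+ k) ℤ.+ (u₂ ℤ.+ o)        ≡⟨ cong (λ i → α ℤ.+ γ ℤ.+ k ℤ.+ i) e ⟩
    (α ℤ.+ γ ℤ.+ k) ℤ.+ (u₁ ℤ.+ u₃ ℤ.+ n) ≡⟨ right α γ k n u₁ u₃ ⟩
    (α ℤ.+ u₁) ℤ.+ (γ ℤ.+ u₃) ℤ.+ (k ℤ.+ n) ∎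
    where
    open ≡-Reasoning
    left : ∀ α γ k o u₂ → (α ℤ.+ γ ℤ.+ (k ℤ.+ o)) ℤ.+ u₂ ≡ (α ℤ.+ γ ℤ.+ k) ℤ.+ (u₂ ℤ.+ o)
    left = ℤ-Solver.solve-∀
    right : ∀ α γ k n u₁ u₃ → (α ℤ.+ γ ℤ.+ k) ℤ.+ (u₁ ℤ.+ u₃ ℤ.+ n) ≡ (α ℤ.+ u₁) ℤ.+ (γ ℤ.+ u₃) ℤ.+ (k ℤ.+ n)
    right = ℤ-Solver.solve-∀

  balance-update : ∀ u {α β γ k o n} → β ≡ α ℤ.+ γ ℤ.+ + (k + o) →
    lookup u (suc zero) ℤ.+ + o ≡ lookup u zero ℤ.+ lookup u (suc (suc zero)) ℤ.+ + n →
    let ν = zipWith ℤ._+_ (α ∷ β ∷ γ ∷ []) u in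
    lookup ν (suc zero) ≡ lookup ν zero ℤ.+ lookup ν (suc (suc zero)) ℤ.+ + (k + n)
  balance-update (u₁ ∷ u₂ ∷ u₃ ∷ []) {α} {β} {γ} {k} {o} {n} = balance-arithmetic {α} {β} {γ} {+ k} {+ o} {+ n}

  move-balanced : ∀ {σ x y} → Allowed σ → Move σ x y → Balanced (proj₁ x) → Balanced (proj₁ y)
  move-balanced {σ} {⟪ _ , _ , α ∷ β ∷ γ ∷ [] ⟫ , _} allowed
    record { position = z ; tree≡ = refl ; tree′≡ = refl ; valuation≡ = refl } balanced
    with k , m , m′ ← units-moved (λ _ → 1) z {Spec.old σ} {Spec.new σ} refl refl
    rewrite m | m′ = balance-update (Spec.update σ) {k = k} balanced (update-balanced allowed)

  data Drained : Configuration system → Set where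
    drained : ∀ {s t} → total t ≡ 0 → Drained ⟪ s , t , 0ℤ ∷ 0ℤ ∷ 0ℤ ∷ [] ⟫

  -- Only `finish` leads to `final`; its guard makes the counters zero, and then the balance does
  -- the rest.
  move-drained : ∀ {σ x y} → Allowed σ → Move σ x y → Balanced (proj₁ x) →
                 state (proj₁ y) ≡ encode final → Drained (proj₁ y)
  move-drained {σ} {⟪ _ , _ , α ∷ β ∷ γ ∷ [] ⟫ , _} allowed
    m@record { to≡ = to≡ } balanced e with encode-injective {Spec.to σ} {final} (trans to≡ e)
  move-drained {y = ⟪ _ , _ , _ ⟫ , _} (finish _)
    m@record { guardHolds = refl , refl , refl ; tree≡ = refl ; tree′≡ = refl ; valuation≡ = refl } balanced e
    | refl = drained (ℤ.+-injective (trans (sym (ℤ.+-identityˡ _)) (sym balanced)))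

  good-drained : ∀ {s c age} → s ≡ final → Drained c → Good s c age
  good-drained refl (drained e) =
    (λ l → ⊥-elim (ℕ.<⇒≱ (weight-labelled (onRegisters (λ _ → 1)) l) (ℕ.≤-reflexive e))) , tt

  module _ {σ x y} (move : Move σ x y) where
    open Spec σ
    open Move move

    survives : ∀ {η b} → ¬ path position ⊑ η → Labelled (tree (proj₁ x)) η b → Labelled (tree (proj₁ y)) η b
    survives out l = subst (λ t → Labelled t _ _) (sym tree′≡)
      (labelled-outside position out (subst (λ t → Labelled t _ _) tree≡ l))

    age-outside : ∀ {η} → ¬ path position ⊑ η →
                  proj₂ y η ≡ change (encode from) (encode to) + proj₂ x η
    age-outside {η} out = trans (cong (λ f → f η) age≡) (renew-outside out)

    -- A unit that is too old is never rewritten, but none is left at the end.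
    good-young : ∀ {s} → Good s (proj₁ y) (proj₂ y) →
                 ∀ {η r} → Labelled (tree (proj₁ x)) η (leaf-sym (suc r)) → proj₂ x η ≤ 1
    good-young good {η} l with path position ⊑? η
    ... | yes (η′ , refl) =
      young {η′} (labelled-below position (subst (λ t → Labelled t (path position ++ η′) _) tree≡ l))
    ... | no out = ℕ.≤-trans (ℕ.m≤n+m _ (change (encode from) (encode to)))
      (subst (_≤ 1) (age-outside out) (proj₁ good (survives out l)))

    not-rewritten : ∀ {i j η} → old ≡ leafᶠ i → i ≢ j → Labelled (tree (proj₁ x)) η (leaf-sym j) →
                    ¬ path position ⊑ η
    not-rewritten refl i≢j l (η′ , refl) with labelled-leaf
      (labelled-below position (subst (λ t → Labelled t (path position ++ η′) _) tree≡ l))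
    ... | _ , refl = i≢j refl

  prepend : ∀ {q v q′ v′} → _⟶_ N (q , v) (q′ , v′) → Halts q′ v′ → Halts q v
  prepend s (l , w , p , h) = l , w , s ◅ p , h

  unit-removed : ∀ {v r} z m → Matches v (plug z (flat (unit r))) → lookup v r ≡ suc m →
                 Matches (v [ r ]≔ m) (plug z (flat x))
  unit-removed {v} {r} z m matches e = matching at-register
    where
    at-register : ∀ r′ → lookup (v [ r ]≔ m) r′ ≡ stored r′ (plug z (flat x))
    at-register r′
      with k , t , t′ ← units-moved (λ r″ → indicator (r′ Fin.≟ r″)) z {unit r} {x}
             (units-flat-leaf _ (suc r)) refl
      with r Fin.≟ r′
    ... | yes refl = trans (Vec.lookup∘update r v m) (ℕ.suc-injective (trans (sym e) (trans (match matches r)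
            (trans t (trans (cong (_+_ k) (indicator-yes (r Fin.≟ r) refl)) (trans (ℕ.+-suc k 0) (cong suc (sym t′))))))))
    ... | no r≢r′ = trans (Vec.lookup∘update′ (r≢r′ ∘ sym) v m) (trans (match matches r′)
            (trans t (trans (cong (_+_ k) (indicator-no (r′ Fin.≟ r) (r≢r′ ∘ sym))) (sym t′))))

  unit-created : ∀ {v r} z → Matches v (plug z (flat x)) →
                 Matches (v [ r ]≔ suc (lookup v r)) (plug z (flat (growᶠ r)))
  unit-created {v} {r} z matches = matching at-register
    where
    at-register : ∀ r′ → lookup (v [ r ]≔ suc (lookup v r)) r′ ≡ stored r′ (plug z (flat (growᶠ r)))
    at-register r′
      with k , t , t′ ← units-moved (λ r″ → indicator (r′ Fin.≟ r″)) z {x} {growᶠ r} refl (units-grow _ r)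
      with r Fin.≟ r′
    ... | yes refl = trans (Vec.lookup∘update r v _) (trans (cong suc (trans (match matches r) t))
            (trans (sym (ℕ.+-suc k 0)) (trans (cong (_+_ k) (sym (indicator-yes (r Fin.≟ r) refl))) (sym t′))))
    ... | no r≢r′ = trans (Vec.lookup∘update′ (r≢r′ ∘ sym) v _) (trans (match matches r′)
            (trans t (trans (cong (_+_ k) (sym (indicator-no (r′ Fin.≟ r) (r≢r′ ∘ sym)))) (sym t′))))

  unit-present : ∀ {v r} z → Matches v (plug z (flat (unit r))) → ∃ λ m → lookup v r ≡ suc m
  unit-present {v} {r} z matches
    with k , t , _ ← units-moved (λ r′ → indicator (r Fin.≟ r′)) z {unit r} {unit r}
           (units-flat-leaf _ (suc r)) refl =
    k , trans (match matches r) (trans t (trans (cong (_+_ k) (indicator-yes (r Fin.≟ r) refl)) (ℕ.+-comm k 1)))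

  keep-input : ∀ {γ} → γ ℤ.+ 0ℤ ≡ 0ℤ → γ ≡ 0ℤ
  keep-input {γ} e = trans (sym (ℤ.+-identityʳ γ)) e

  fetch-units : ∀ w z → ∃ λ k → units w (plug z (flat x)) ≡ k + 0 ×
                units w (plug z (flat (growᶠ zero))) ≡ k + w zero
  fetch-units w z = units-moved w z {x} {growᶠ zero} refl (units-grow w zero)

  -- The backward step: what holds after a rule yields what holds before it, with a step of `N`
  -- prepended for `create`, `remove` and `try`. The two halves of a zero test share the work: `try`
  -- supplies the jump, and `pass` the age condition that justifies it.
  simulated : ∀ {σ x y} → Allowed σ → Move σ x y → Good (Spec.to σ) (proj₁ y) (proj₂ y) →
              Simulated (Spec.from σ) (proj₁ x) (proj₂ x)
  simulated {x = ⟪ _ , _ , α ∷ β ∷ γ ∷ [] ⟫ , _} pump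
    record { tree≡ = refl ; tree′≡ = refl ; valuation≡ = refl } (_ , good) {k} t≡ e =
    good t≡ (trans e (cong (ℤ._+_ (+ k)) (sym (ℤ.+-identityʳ γ))))
  simulated {x = ⟪ _ , _ , α ∷ β ∷ γ ∷ [] ⟫ , _} unload
    record { position = z ; tree≡ = refl ; tree′≡ = refl ; valuation≡ = refl } (_ , good) {k} t≡ e
    with k′ , refl , t′≡ ← unload-chain z k t≡ = good t′≡ (trans e (shift (+ k′) γ))
    where
    shift : ∀ i j → 1ℤ ℤ.+ i ℤ.+ j ≡ i ℤ.+ (j ℤ.+ 1ℤ)
    shift = ℤ-Solver.solve-∀
  simulated {x = ⟪ _ , _ , α ∷ β ∷ γ ∷ [] ⟫ , _} enter
    record { position = z ; tree≡ = refl ; tree′≡ = refl ; valuation≡ = refl } (_ , good) {k} t≡ e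
    -- The chain is used up here, so the input is the third counter and no register holds a unit.
    with refl , refl ← enter-chain z k t≡ =
    good (trans e (cong (ℤ._+_ 0ℤ) (sym (ℤ.+-identityʳ γ)))) (λ r → Vec.lookup-replicate r 0)
  simulated {x = ⟪ _ , _ , α ∷ β ∷ γ ∷ [] ⟫ , _} fetch
    record { position = z ; tree≡ = refl ; tree′≡ = refl ; valuation≡ = refl } (_ , good) {n} {v} e matches =
    good (fetched (fetch-units (λ r → indicator (zero Fin.≟ r)) z) e)
      (λ r → trans (matches r) (unchanged (fetch-units (λ r′ → indicator (suc r Fin.≟ r′)) z)))
    where
    shift : ∀ i j → i ℤ.+ 0ℤ ℤ.+ j ≡ i ℤ.+ 1ℤ ℤ.+ (j ℤ.+ -1ℤ)
    shift = ℤ-Solver.solve-∀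
    fetched : ∀ {a b} → ∃ (λ k → a ≡ k + 0 × b ≡ k + 1) → + n ≡ + a ℤ.+ γ → + n ≡ + b ℤ.+ (γ ℤ.+ -1ℤ)
    fetched (k , refl , refl) e = trans e (shift (+ k) γ)
    unchanged : ∀ {a b} → ∃ (λ k → a ≡ k + 0 × b ≡ k + 0) → a ≡ b
    unchanged (k , refl , refl) = refl
  simulated {x = ⟪ _ , _ , α ∷ β ∷ γ ∷ [] ⟫ , _} go
    record { tree≡ = refl ; tree′≡ = refl ; valuation≡ = refl } (_ , i≡0 , good) e matches =
    -- The third counter is already zero at this point, since `Simulated` requires this in `main`;
    -- hence all of the input has been fetched.
    good (matching λ { zero → fetched (keep-input i≡0) e
           ; (suc r) → matches r })
    where
    fetched : ∀ {n m} → γ ≡ 0ℤ → + n ≡ + m ℤ.+ γ → n ≡ m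
    fetched refl e = trans (ℤ.+-injective e) (ℕ.+-identityʳ _)
  simulated {x = ⟪ _ , _ , α ∷ β ∷ γ ∷ [] ⟫ , _} (refresh q i)
    record { tree≡ = refl ; tree′≡ = refl ; valuation≡ = refl } (_ , i≡0 , good) =
    keep-input i≡0 , good
  simulated {x = ⟪ _ , _ , α ∷ β ∷ γ ∷ [] ⟫ , _} (create e)
    record { position = z ; tree≡ = refl ; tree′≡ = refl ; valuation≡ = refl } (_ , i≡0 , good) =
    keep-input i≡0 , λ matches → prepend (inc e) (good (unit-created z matches))
  simulated {x = ⟪ _ , _ , α ∷ β ∷ γ ∷ [] ⟫ , _} (remove e)
    record { position = z ; tree≡ = refl ; tree′≡ = refl ; valuation≡ = refl } (_ , i≡0 , good) =
    keep-input i≡0 , λ matches → let m , present = unit-present z matches in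
      prepend (dec e present) (good (unit-removed z m matches present))
  simulated {x = ⟪ _ , t , α ∷ β ∷ γ ∷ [] ⟫ , age} {y = _ , age′} (try {q} {r} e)
    move@record { tree≡ = refl ; tree′≡ = refl ; valuation≡ = refl } (_ , i≡0 , good) =
    keep-input i≡0 , λ {v} matches → let young , simulated = good e in
      prepend (jzero e (trans (match matches r) (empty young _ refl))) (simulated matches)
    where
    open Move move
    empty : (∀ {η} → Labelled _ η (leaf-sym (suc r)) → age′ η ≤ 0) → ∀ k → stored r t ≡ k → stored r t ≡ 0
    empty young zero    none = none
    -- A unit of register `r` is untouched by `try`, which rewrites a place `x`. The state change
    -- gives it age at least 1, against the bound 0 that holds in `test`.
    empty young (suc k) some with η , l ← stored-labelled t some
      with out ← not-rewritten move {zero} {suc r} refl (λ ()) l =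
      ⊥-elim (ℕ.1+n≢0 (ℕ.n≤0⇒n≡0 (subst (_≤ 0)
        (trans (age-outside move out) (cong (λ d → d + age η) (change-differ {main q} {test q} λ ()))) (young l))))
  simulated {x = ⟪ _ , _ , α ∷ β ∷ γ ∷ [] ⟫ , age} (retain {q} e i i≢)
    move@record { tree≡ = refl ; tree′≡ = refl ; valuation≡ = refl } (_ , i≡0 , good) =
    keep-input i≡0 , λ e′ → let young , simulated = good e′ in
      (λ {η} l → subst (_≤ 0) (trans (age-outside move (outside e′ l)) (cong (λ d → d + age η) (change-same (test q))))
        (young l)) , simulated
    where
    outside : ∀ {r′ l₁ l₂ η} → lookup program q ≡ dec r′ l₁ l₂ → Labelled _ η (leaf-sym (suc r′)) →
              ¬ path (Move.position move) ⊑ η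
    outside e′ l with refl ← trans (sym e) e′ = not-rewritten move refl i≢ l
  simulated {x = ⟪ _ , _ , α ∷ β ∷ γ ∷ [] ⟫ , age} (pass {q} e)
    move@record { tree≡ = refl ; tree′≡ = refl ; valuation≡ = refl } (young , i≡0 , good) =
    keep-input i≡0 , λ e′ →
      -- Such a unit is not rewritten by `pass` and has age at most 1 after the state change, hence
      -- age 0 before it.
      (λ {η} l → ℕ.≤-pred (subst (_≤ 1) (trans (age-outside move (not-rewritten move {zero} refl (λ ()) l))
        (cong (λ d → d + age η) (change-differ {test q} {main _} λ ()))) (young l))) ,
      (λ matches → continue e′ matches)
    where
    continue : ∀ {r l l′} → lookup program q ≡ dec r l l′ → ∀ {v} → Matches v _ → Halts l′ v
    continue e′ with refl ← trans (sym e) e′ = good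
  simulated {x = ⟪ _ , _ , α ∷ β ∷ γ ∷ [] ⟫ , _} (drain e r)
    record { valuation≡ = refl } (_ , i≡0 , good) =
    keep-input i≡0 , λ _ → _ , _ , ε , e
  simulated {x = ⟪ _ , _ , α ∷ β ∷ γ ∷ [] ⟫ , _} (finish e)
    record { guardHolds = _ , _ , i≡0 } good = i≡0 , λ _ → _ , _ , ε , e

  -- The balance is passed forward along the run and `Good` is returned backwards, starting from
  -- `final`, where no unit is left that could be too old.
  sound : ∀ {x y} → Star _⟿_ x y → state (proj₁ y) ≡ encode final →
          Balanced (proj₁ x) → (state (proj₁ x) ≡ encode final → Drained (proj₁ x)) →
          ∀ s → encode s ≡ state (proj₁ x) → Good s (proj₁ x) (proj₂ x)
  sound ε at-final _ drained-if s e = good-drained {s} (encode-injective (trans e at-final)) (drained-if at-final)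
  sound (step ◅ steps) at-final balanced drained-if s e
    with σ , allowed , move ← step⇒move step
    with refl ← encode-injective {s} {Spec.from σ} (trans e (sym (Move.from≡ move)))
    with good ← sound steps at-final (move-balanced allowed move balanced)
           (move-drained allowed move balanced) (Spec.to σ) (Move.to≡ move) =
    good-young move {Spec.to σ} good , simulated allowed move good

  -- Completeness: from accepting computations to runs

  infix 4 _⟱_ _⟰_
  _⟱_ _⟰_ : Aged system → Aged system → Set
  _⟱_ = Down system 1
  _⟰_ = Up system 1

  counters : ℕ → ℕ → ℕ → Vec ℤ 3
  counters α β γ = + α ∷ + β ∷ + γ ∷ []

  counters-≤ : ∀ {α β γ α′ β′ γ′} → α ≤ α′ → β ≤ β′ → γ ≤ γ′ →
               ∀ k → lookup (counters α β γ) k ℤ.≤ lookup (counters α′ β′ γ′) k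
  counters-≤ a b c zero             = +≤+ a
  counters-≤ a b c (suc zero)       = +≤+ b
  counters-≤ a b c (suc (suc zero)) = +≤+ c

  counters-same : ∀ {α β γ} → counters α β γ ≡ zipWith ℤ._+_ (counters α β γ) keep
  counters-same = sym (Vec.zipWith-identityʳ {f = ℤ._+_} ℤ.+-identityʳ _)

  counters-cong : ∀ {i j k i′ j′ k′ : ℤ} → i ≡ i′ → j ≡ j′ → k ≡ k′ →
                  _≡_ {A = Vec ℤ 3} (i ∷ j ∷ k ∷ []) (i′ ∷ j′ ∷ k′ ∷ [])
  counters-cong refl refl refl = refl

  no-change : ∀ n → + n ≡ + n ℤ.+ 0ℤ
  no-change n = sym (ℤ.+-identityʳ (+ n))

  increment : ∀ n → + suc n ≡ + n ℤ.+ 1ℤ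
  increment n = cong +_ (ℕ.+-comm 1 n)

  leaf-move : ∀ {σ i t ν ν′ age η} → Spec.old σ ≡ leafᶠ i → Holds (Spec.guard σ) ν →
    ν′ ≡ zipWith ℤ._+_ ν (Spec.update σ) → Labelled t η (leaf-sym i) → age η ≤ 1 →
    ∃ λ z → path z ≡ η × t ≡ plug z (flat (Spec.old σ)) ×
      Move σ (⟪ encode (Spec.from σ) , t , ν ⟫ , age)
             (⟪ encode (Spec.to σ) , plug z (flat (Spec.new σ)) , ν′ ⟫ ,
              renew (path z) (change (encode (Spec.from σ)) (encode (Spec.to σ))) age)
  leaf-move {σ} {i} {age = age} refl g v l a≤1 with focus l
  ... | z , ts , refl , t≡ = z , refl , t≡′ , record
    { from≡ = refl ; to≡ = refl ; guardHolds = g ; valuation≡ = v ; position = z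
    ; tree≡ = t≡′ ; tree′≡ = refl
    ; young = λ l′ → case labelled-leaf l′ of λ
        { (refl , _) → subst (λ η → age η ≤ 1) (sym (List.++-identityʳ (path z))) a≤1 }
    ; age≡ = refl }
    where
    t≡′ = trans t≡ (cong (plug z) (trans (leaf-unique i ts) (sym (flat-leaf i))))

  YoungUnits : ℕ → Tree rank → (Node → ℕ) → Set
  YoungUnits m t age = ∀ {η r} → Labelled t η (leaf-sym (suc r)) → age η ≤ m

  -- Besides the units, one place `x` has to stay young: creating a unit, testing for zero and
  -- finishing all rewrite such a leaf.
  Live : ℕ → Tree rank → (Node → ℕ) → Set
  Live m t age = YoungUnits m t age × ∃ λ η → Labelled t η (leaf-sym zero) × age η ≤ m

  live-weaken : ∀ {m n t age} → m ≤ n → Live m t age → Live n t age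
  live-weaken m≤n (units , η , l , a) =
    (λ l → ℕ.≤-trans (units l) m≤n) , η , l , ℕ.≤-trans a m≤n

  live-after : ∀ {m d} z {s s′ age η} → Labelled s′ η (leaf-sym zero) → YoungUnits m (plug z s) age →
               Live (d + m) (plug z s′) (renew (path z) d age)
  live-after {m} {d} z {s} {s′} {age} {η} l young =
    young′ , path z ++ η , labelled-inside z l , ℕ.≤-trans (ℕ.≤-reflexive (renew-below (path z) d age η)) z≤n
    where
    young′ : YoungUnits (d + m) (plug z s′) (renew (path z) d age)
    young′ {η} l with path z ⊑? η
    ... | yes _  = z≤n
    ... | no out = ℕ.+-monoʳ-≤ d (young (labelled-outside z out l))

  module _ {s : State} {P : Fin (suc registers) → Set} (P? : Decidable P)
           (refreshable : ∀ i → P i → Allowed (spec s (leafᶠ i) (leafᶠ i) s tt keep))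
           (t : Tree rank) (α β γ : ℕ) where

    c : Configuration system
    c = ⟪ encode s , t , counters α β γ ⟫

    -- Refreshing changes neither tree nor valuation, so addresses in the list stay valid. `younger`
    -- keeps leaves already visited at age 0 and those still to come within the lifespan.
    record Refresh (age : Node → ℕ) (xs : List (∃₂ λ η a → Labelled t η a)) : Set where
      field
        age′    : Node → ℕ
        steps   : Star _⟱_ (c , age) (c , age′)
        younger : ∀ η → age′ η ≤ age η
        fresh   : ∀ {η i} {l : Labelled t η (leaf-sym i)} → (η , leaf-sym i , l) ∈ xs →
                  P i → age η ≤ 1 → age′ η ≡ 0

    refreshOne : ∀ {η i} → Labelled t η (leaf-sym i) → P i → ∀ age → age η ≤ 1 → ∃ λ age′ →
                 (c , age) ⟱ (c , age′) × (∀ η → age′ η ≤ age η) × age′ η ≡ 0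
    refreshOne {η} {i} l p age a≤1
      with z , refl , t≡ , move ← leaf-move {spec s (leafᶠ i) (leafᶠ i) s tt keep} {i}
             {ν = counters α β γ} {age = age} refl tt refl l a≤1 =
      _ , (subst₂ (λ t′ ν → (c , age) ⟿ (⟪ encode s , t′ , ν ⟫ , renew (path z) d age)) (sym t≡) (sym counters-same)
             (move⇒step (refreshable i p) move) , counters-≤ ℕ.≤-refl ℕ.≤-refl ℕ.≤-refl) ,
      (λ η → ℕ.≤-trans (renew-≤ (path z) d age η) (ℕ.≤-reflexive (cong (λ d → d + age η) (change-same s)))) ,
      trans (cong (renew (path z) d age) (sym (List.++-identityʳ (path z)))) (renew-below (path z) d age [])
      where d = change (encode s) (encode s)

    refreshList : ∀ xs age → Refresh age xs
    refreshList [] age = record { age′ = age ; steps = ε ; younger = λ _ → ℕ.≤-refl ; fresh = λ () }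
    refreshList ((η , a , l) ∷ xs) age with refreshable? a l
      where
      refreshable? : ∀ a → Labelled t η a → (∃ λ i → a ≡ leaf-sym i × P i × age η ≤ 1) ⊎
                     (∀ {i} → a ≡ leaf-sym i → P i → age η ≤ 1 → ⊥)
      refreshable? a-sym l = inj₂ λ ()
      refreshable? c-sym l = inj₂ λ ()
      refreshable? f-sym l = inj₂ λ ()
      refreshable? (leaf-sym i) l with P? i | age η ℕ.≤? 1
      ... | yes p | yes a≤1 = inj₁ (i , refl , p , a≤1)
      ... | no ¬p | _       = inj₂ λ { refl p _ → ¬p p }
      ... | _     | no a≰1  = inj₂ λ _ _ a≤1 → a≰1 a≤1
    ... | inj₂ impossible = record
      { age′ = age′ ; steps = steps ; younger = younger
      ; fresh = λ { (here refl) p a≤1 → ⊥-elim (impossible refl p a≤1)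
                  ; (there m) p a≤1 → fresh m p a≤1 } }
      where open Refresh (refreshList xs age)
    ... | inj₁ (i , refl , p , a≤1) with refreshOne l p age a≤1
    ... | age₁ , step , younger₁ , fresh₁ = record
      { age′ = age′ ; steps = step ◅ steps
      ; younger = λ η → ℕ.≤-trans (younger η) (younger₁ η)
      ; fresh = λ { (here refl) _ _ → ℕ.n≤0⇒n≡0 (ℕ.≤-trans (younger η) (ℕ.≤-reflexive fresh₁))
                  ; (there m) p a≤1 → fresh m p (ℕ.≤-trans (younger₁ _) a≤1) } }
      where open Refresh (refreshList xs age₁)

    refreshAll : P zero → (∀ {η r} → Labelled t η (leaf-sym (suc r)) → P (suc r)) →
                 ∀ {age} → Live 1 t age → ∃ λ age′ → Star _⟱_ (c , age) (c , age′) × Live 0 t age′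
    refreshAll p₀ pᵣ {age} (units , η , l , a≤1) = age′ , steps ,
      (λ l → ℕ.≤-reflexive (fresh (∈-nodes t l) (pᵣ l) (units l))) ,
      η , l , ℕ.≤-reflexive (fresh (∈-nodes t l) p₀ a≤1)
      where open Refresh (refreshList (nodes t) age)

  cfg : State → Tree rank → ℕ → ℕ → ℕ → Configuration system
  cfg s t α β γ = ⟪ encode s , t , counters α β γ ⟫

  leaf-step : ∀ {σ i t α β γ α′ β′ γ′ age η m η′} → Allowed σ → Spec.old σ ≡ leafᶠ i →
    Holds (Spec.guard σ) (counters α β γ) →
    counters α′ β′ γ′ ≡ zipWith ℤ._+_ (counters α β γ) (Spec.update σ) →
    α′ ≤ α → β′ ≤ β → γ′ ≤ γ →
    Labelled (flat (Spec.new σ)) η′ (leaf-sym zero) →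
    Labelled t η (leaf-sym i) → age η ≤ 1 → YoungUnits m t age →
    ∃₂ λ z age′ → t ≡ plug z (flat (Spec.old σ)) ×
      (cfg (Spec.from σ) t α β γ , age) ⟱ (cfg (Spec.to σ) (plug z (flat (Spec.new σ))) α′ β′ γ′ , age′) ×
      Live (change (encode (Spec.from σ)) (encode (Spec.to σ)) + m) (plug z (flat (Spec.new σ))) age′
  leaf-step {σ} allowed old≡ g v a b c x∈ l a≤1 young with leaf-move {σ} old≡ g v l a≤1
  ... | z , refl , refl , move =
    z , _ , refl , (move⇒step allowed move , counters-≤ a b c) , live-after z x∈ young

  Finishes : Aged system → Set
  Finishes y = ∃ λ y′ → Star _⟱_ y y′ × state (proj₁ y′) ≡ encode final

  infixr 5 _▸_ _▸▸_
  _▸_ : ∀ {y y′} → y ⟱ y′ → Finishes y′ → Finishes y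
  s ▸ (y″ , p , e) = y″ , s ◅ p , e

  _▸▸_ : ∀ {y y′} → Star _⟱_ y y′ → Finishes y′ → Finishes y
  p ▸▸ (y″ , q , e) = y″ , p ◅◅ q , e

  total-removed : ∀ {r} z → total (plug z (flat (unit r))) ≡ suc (total (plug z (flat x)))
  total-removed {r} z with k , e , e′ ← units-moved (λ _ → 1) z {unit r} {x} (units-flat-leaf (λ _ → 1) (suc r)) refl =
    trans e (trans (ℕ.+-suc k 0) (cong suc (sym e′)))

  total-created : ∀ {r} z → total (plug z (flat (growᶠ r))) ≡ suc (total (plug z (flat x)))
  total-created {r} z with k , e , e′ ← units-moved (λ _ → 1) z {growᶠ r} {x} (units-grow (λ _ → 1) r) refl =
    trans e (trans (ℕ.+-suc k 0) (cong suc (sym e′)))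

  -- The second counter equals the number of units, so both reach zero together. The state stays the
  -- same meanwhile, so nothing ages.
  drainAll : ∀ {q} → lookup program q ≡ halt true → ∀ n {t age} → total t ≡ n → Live 1 t age →
             Finishes (cfg (main q) t 0 n 0 , age)
  drainAll h zero e (young , η , l , a≤1)
    with z , age′ , _ , step , _ ← leaf-step (finish h) refl (refl , refl , refl) counters-same
           z≤n z≤n z≤n root l a≤1 young = step ▸ (_ , ε , refl)
  drainAll {q} h (suc n) {t} e (young , _) with weight-pos _ t e
  ... | η , a-sym , l , pos = ⊥-elim (pos refl)
  ... | η , c-sym , l , pos = ⊥-elim (pos refl)
  ... | η , f-sym , l , pos = ⊥-elim (pos refl)
  ... | η , leaf-sym zero , l , pos = ⊥-elim (pos refl)
  ... | η , leaf-sym (suc r) , l , pos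
    with z , age′ , refl , step , live ← leaf-step {γ = 0} {α′ = 0} {β′ = n} {γ′ = 0} (drain h r) refl tt refl
           z≤n (ℕ.n≤1+n n) z≤n root l (young l) young =
    step ▸ drainAll h n (ℕ.suc-injective (trans (sym (total-removed z)) e))
      (subst (λ d → Live (d + 1) (plug z (flat x)) age′) (change-same (main q)) live)

  refreshMain : ∀ q {t α β γ age} → Live 1 t age → ∃ λ age′ →
                Star _⟱_ (cfg (main q) t α β γ , age) (cfg (main q) t α β γ , age′) × Live 0 t age′
  refreshMain q {t} {α} {β} {γ} =
    refreshAll {main q} {λ _ → ⊤} (λ _ → yes tt) (λ i _ → refresh q i) t α β γ tt (λ _ → tt)

  refreshTest : ∀ {q r l l′} → lookup program q ≡ dec r l l′ → ∀ {t α β γ age} → stored r t ≡ 0 → Live 1 t age →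
                ∃ λ age′ → Star _⟱_ (cfg (test q) t α β γ , age) (cfg (test q) t α β γ , age′) × Live 0 t age′
  refreshTest {q} {r} e {t} {α} {β} {γ} empty =
    refreshAll {test q} {λ i → i ≢ suc r} (λ i → ¬? (i Fin.≟ suc r)) (retain e) t α β γ (λ ())
      (λ { l refl → ℕ.1+n≢0 (ℕ.n≤0⇒n≡0 (subst₂ _≤_ (indicator-yes (r Fin.≟ r) refl) empty (weight-labelled _ l))) })

  -- An instruction may jump to its own label, and then the state does not change and nothing ages;
  -- the bound 1 covers both cases.
  live-≤1 : ∀ s s′ {t age} → Live (change (encode s) (encode s′) + 0) t age → Live 1 t age
  live-≤1 s s′ = live-weaken (ℕ.≤-trans (ℕ.≤-reflexive (ℕ.+-identityʳ _)) (indicator≤1 (¬? (encode s Fin.≟ encode s′))))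

  -- `α` is the number of increments in the computation. It is chosen before the tree is known
  -- because it has to be pumped at the very start. The second counter is `α + total t`, as each
  -- unit present or yet to be created is eventually removed, at the latest by draining.
  complete : ∀ {q v l w} → Star (_⟶_ N) (q , v) (l , w) → lookup program l ≡ halt true →
    ∃ λ α → ∀ {t age} → Matches v t → Live 1 t age → Finishes (cfg (main q) t α (α + total t) 0 , age)
  complete ε h = 0 , λ _ live → drainAll h _ refl live
  complete {q} (inc {r = r} {l′} e ◅ p) h with complete p h
  ... | α , rest = suc α , λ {t} {age} matches live → created t age _ refl matches live
    where
    created : ∀ t age β → suc α + total t ≡ β → Matches _ t → Live 1 t age →
              Finishes (cfg (main q) t (suc α) β 0 , age)
    created t age β β≡ matches live
      with age₁ , steps , young , η , l , a≤0 ← refreshMain q live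
      with z , age₂ , refl , step , live₂ ← leaf-step {γ = 0} {α′ = α} {β′ = β} {γ′ = 0} (create e) refl tt
             (counters-cong refl (no-change _) refl) (ℕ.n≤1+n α) ℕ.≤-refl z≤n
             (child zero root) l (ℕ.≤-trans a≤0 z≤n) young =
      steps ▸▸ step ▸ subst (λ β → Finishes (cfg (main l′) (plug z (flat (growᶠ r))) α β 0 , age₂))
        (trans (cong (_+_ α) (total-created z)) (trans (ℕ.+-suc α _) β≡))
        (rest (unit-created {_} {r} z matches) (live-≤1 (main q) (main l′) live₂))
  complete {q} {v} (dec {r = r} {l′} {m = m} e present ◅ p) h with complete p h
  ... | α , rest = α , λ {t} {age} matches live →
    let n , t≡ = total-positive t (proj₂ (stored-labelled t (trans (sym (match matches r)) present)))
    in subst (λ β → Finishes (cfg (main q) t α β 0 , age)) (trans (sym (ℕ.+-suc α n)) (cong (_+_ α) (sym t≡)))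
         (removed t n age t≡ matches live)
    where
    total-positive : ∀ t {η} → Labelled t η (leaf-sym (suc r)) → ∃ λ n → total t ≡ suc n
    total-positive t l with total t | weight-labelled (onRegisters (λ _ → 1)) l
    ... | suc n | _ = n , refl

    removed : ∀ t n age → total t ≡ suc n → Matches v t → Live 1 t age →
              Finishes (cfg (main q) t α (suc (α + n)) 0 , age)
    removed t n age t≡ matches live
      with age₁ , steps , young , _ ← refreshMain q live
      with η , l ← stored-labelled t (trans (sym (match matches r)) present)
      with z , age₂ , refl , step , live₂ ← leaf-step {γ = 0} {α′ = α} {β′ = α + n} {γ′ = 0} (remove e) refl tt
             (counters-cong (no-change _) refl refl) ℕ.≤-refl (ℕ.n≤1+n _) z≤n
             root l (ℕ.≤-trans (young l) z≤n) young =
      steps ▸▸ step ▸ subst (λ β → Finishes (cfg (main l′) (plug z (flat x)) α β 0 , age₂))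
        (cong (_+_ α) (ℕ.suc-injective (trans (sym (total-removed z)) t≡)))
        (rest (unit-removed z m matches present) (live-≤1 (main q) (main l′) live₂))
  complete {q} {v} (jzero {r = r} {l′} {l″} e absent ◅ p) h with complete p h
  ... | α , rest = α , λ {t} {age} matches live → passed t age _ refl matches live
    where
    passed : ∀ t age β → α + total t ≡ β → Matches v t → Live 1 t age → Finishes (cfg (main q) t α β 0 , age)
    passed t age β β≡ matches live
      with age₁ , steps₁ , young₁ , η₁ , l₁ , a₁ ← refreshMain q {α = α} {β} {0} live
      with z₁ , age₂ , refl , step₁ , live₂ ← leaf-step {γ = 0} {η′ = []} (try e) refl tt counters-same
             ℕ.≤-refl ℕ.≤-refl z≤n root l₁ (ℕ.≤-trans a₁ z≤n) young₁
      -- The tested register is empty, so the leaves that `retain` excludes do not occur and every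
      -- unit can be refreshed between the two state changes.
      with age₃ , steps₂ , young₃ , η₃ , l₃ , a₃ ← refreshTest e (trans (sym (match matches r)) absent)
             (live-≤1 (main q) (test q) live₂)
      with z₂ , age₄ , t≡ , step₂ , live₄ ← leaf-step {γ = 0} {η′ = []} (pass e) refl tt counters-same
             ℕ.≤-refl ℕ.≤-refl z≤n root l₃ (ℕ.≤-trans a₃ z≤n) young₃ =
      steps₁ ▸▸ step₁ ▸ steps₂ ▸▸ step₂ ▸ subst (λ β → Finishes (cfg (main l″) (plug z₂ (flat x)) α β 0 , age₄))
        (trans (cong (λ t → α + total t) (sym t≡)) β≡)
        (rest (subst (Matches v) t≡ matches) (live-≤1 (test q) (main l″) live₄))

  fetchAll : ∀ {α β v} k {n t age} → Matches (n ∷ v) t → Live 0 t age → ∃₂ λ t′ age′ →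
    Star _⟱_ (cfg load t α β k , age) (cfg load t′ α β 0 , age′) ×
    Matches (k + n ∷ v) t′ × Live 0 t′ age′ × total t′ ≡ k + total t
  fetchAll zero matches live = _ , _ , ε , matches , live , refl
  fetchAll {α} {β} {v} (suc k) {n} matches (young , η , l , a≤0)
    with z , age₁ , refl , step , live₁ ← leaf-step {γ′ = k} fetch refl tt (counters-cong (no-change _) (no-change _) refl)
           ℕ.≤-refl ℕ.≤-refl (ℕ.n≤1+n k) (child zero root) l (ℕ.≤-trans a≤0 z≤n) young
    with t′ , age₂ , steps , matches′ , live₂ , e ← fetchAll {α} {β} k (unit-created z matches)
           (subst (λ d → Live (d + 0) (plug z (flat (growᶠ zero))) age₁) (change-same load) live₁) =
    t′ , age₂ , step ◅ steps , subst (λ m → Matches (m ∷ v) t′) (ℕ.+-suc k n) matches′ , live₂ ,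
    trans e (trans (cong (_+_ k) (total-created z)) (ℕ.+-suc k _))

  recount : ∀ {T : Aged system → Aged system → Set} {y s t α β γ α′ β′ γ′ age} → α ≡ α′ → β ≡ β′ → γ ≡ γ′ →
            Star T y (cfg s t α β γ , age) → Star T y (cfg s t α′ β′ γ′ , age)
  recount refl refl refl p = p

  tower-place : ∀ n → ∃ λ η → Labelled (tower {registers} n) η (leaf-sym zero)
  tower-place zero    = [] , root
  tower-place (suc n) = let η , l = tower-place n in 1 ∷ η , child zero l

  tower-zipper : ℕ → Zipper rank
  tower-zipper zero    = hole
  tower-zipper (suc n) = down a-sym zero (tower n ∷ []) (tower-zipper n)

  tower-unwrapᵃ : ∀ n → tower (suc n) ≡ plug (tower-zipper n) (flat unwrapᵃ)
  tower-unwrapᵃ zero    = refl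
  tower-unwrapᵃ (suc n) = cong (λ t → node a-sym (t ∷ [])) (tower-unwrapᵃ n)

  tower-x : ∀ n → tower n ≡ plug (tower-zipper n) (flat x)
  tower-x zero    = refl
  tower-x (suc n) = cong (λ t → node a-sym (t ∷ [])) (tower-x n)

  -- Pumping and unloading stay in `start′`, so no age ever leaves 0.
  Newborn : (Node → ℕ) → Set
  Newborn age = ∀ η → age η ≡ 0

  newborn-young : ∀ {age} → Newborn age → ∀ η → age η ≤ 1
  newborn-young newborn η = ℕ.≤-trans (ℕ.≤-reflexive (newborn η)) z≤n

  newborn-after : ∀ s {π age} → Newborn age → Newborn (renew π (change (encode s) (encode s)) age)
  newborn-after s {π} {age} newborn η = ℕ.n≤0⇒n≡0 (ℕ.≤-trans (renew-≤ π _ age η)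
    (ℕ.≤-reflexive (cong₂ _+_ (change-same s) (newborn η))))

  pumpAll : ∀ k {n α β age} → Newborn age → ∃ λ age′ → Newborn age′ ×
    Star _⟰_ (cfg start′ (chain n) α β 0 , age) (cfg start′ (chain n) (k + α) (k + β) 0 , age′)
  pumpAll zero newborn = _ , newborn , ε
  pumpAll (suc k) {n} {α} {β} {age} newborn
    with η , l ← tower-place n
    with z , _ , t≡ , move ← leaf-move {spec start′ x x start′ tt (1ℤ ∷ 1ℤ ∷ 0ℤ ∷ [])} {ν = counters α β 0}
           {ν′ = counters (suc α) (suc β) 0} {age = age}
           refl tt (counters-cong (increment α) (increment β) refl) (child zero l) (newborn-young newborn (1 ∷ η))
    with age′ , newborn′ , steps ← pumpAll k {n} {suc α} {suc β} (newborn-after start′ {path z} newborn) =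
    age′ , newborn′ ,
    (subst (λ t → (cfg start′ (chain n) α β 0 , age) ⟿
        (cfg start′ t (suc α) (suc β) 0 , renew (path z) (change (encode start′) (encode start′)) age))
       (sym t≡) (move⇒step pump move) ,
      counters-≤ (ℕ.n≤1+n α) (ℕ.n≤1+n β) z≤n) ◅
    recount (ℕ.+-suc k α) (ℕ.+-suc k β) refl steps

  unloadAll : ∀ n {α β γ age} → Newborn age → ∃ λ age′ → Newborn age′ ×
    Star _⟰_ (cfg start′ (chain n) α β γ , age) (cfg start′ (chain 0) α (n + β) (n + γ) , age′)
  unloadAll zero newborn = _ , newborn , ε
  unloadAll (suc n) {α} {β} {γ} {age} newborn
    with age′ , newborn′ , steps ← unloadAll n {α} {suc β} {suc γ}
           (newborn-after start′ {1 ∷ path (tower-zipper n)} newborn) =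
    age′ , newborn′ ,
    (move⇒step unload (record
      { from≡ = refl ; to≡ = refl ; guardHolds = tt
      ; valuation≡ = counters-cong (no-change α) (increment β) (increment γ)
      ; position = down c-sym zero (tower n ∷ []) (tower-zipper n)
      ; tree≡ = cong (λ t → node c-sym (t ∷ [])) (tower-unwrapᵃ n)
      ; tree′≡ = cong (λ t → node c-sym (t ∷ [])) (tower-x n)
      ; young = λ _ → newborn-young newborn _
      ; age≡ = refl }) ,
      counters-≤ ℕ.≤-refl (ℕ.n≤1+n β) (ℕ.n≤1+n γ)) ◅
    recount refl (ℕ.+-suc n β) (ℕ.+-suc n γ) steps

  finishes : ∀ n → Halts start (n ∷ replicate others 0) → ∃₂ λ y y′ →
    Star _⟰_ (cfg start′ (chain n) 0 0 0 , λ _ → 0) y × Star _⟱_ y y′ × state (proj₁ y′) ≡ encode final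
  finishes n (l , w , p , h)
    with α , rest ← complete p h
    with age₁ , newborn₁ , pumps ← pumpAll α {n} {0} {0} {λ _ → 0} (λ _ → refl)
    with age₂ , newborn₂ , unloads ← unloadAll n {α + 0} {α + 0} {0} newborn₁
    -- `enter` changes the state but rewrites the tree at its root, which makes every age 0 again:
    -- hence `renew [] 1 age₂`.
    with t , age₃ , fetches , matches , (young , η , l , a≤0) , t≡ ←
           fetchAll {α + 0} {n + (α + 0)} {replicate others 0} (n + 0) {0} {leaf zero} {renew [] 1 age₂}
             (matching λ r → Vec.lookup-replicate r 0)
             ((λ l → case labelled-leaf {i = zero} l of λ { (_ , ()) }) , [] , root , z≤n)
    with z , age₄ , t≡′ , step , live ← leaf-step {γ = 0} {η′ = []} go refl tt counters-same
           ℕ.≤-refl ℕ.≤-refl z≤n root l (ℕ.≤-trans a≤0 z≤n) young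
    with y′ , steps , e ← rest (subst (λ m → Matches (m ∷ _) _) (trans (ℕ.+-identityʳ _) (ℕ.+-identityʳ n))
           (subst (Matches _) t≡′ matches)) (live-≤1 load (main start) live) =
    _ , y′ , pumps ◅◅ unloads ,
    (move⇒step enter (record
      { from≡ = refl ; to≡ = refl ; guardHolds = tt ; valuation≡ = counters-same
      ; position = hole ; tree≡ = refl ; tree′≡ = refl
      ; young = λ _ → newborn-young newborn₂ _ ; age≡ = refl }) ,
      counters-≤ ℕ.≤-refl ℕ.≤-refl ℕ.≤-refl) ◅
    fetches ◅◅ step ◅ subst₂ (λ i j → Star _⟱_ (cfg (main start) (plug z (flat x)) i j 0 , age₄) y′)
      (sym (ℕ.+-identityʳ α)) (balance t≡ t≡′) steps , e
    where
    balance : ∀ {α t u} → total t ≡ n + 0 + 0 → t ≡ u → α + total u ≡ n + (α + 0)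
    balance {α} t≡ refl = trans (cong (_+_ α) (trans t≡ (trans (ℕ.+-identityʳ _) (ℕ.+-identityʳ n))))
      (trans (ℕ.+-comm α n) (cong (_+_ n) (sym (ℕ.+-identityʳ α))))

  -- Reachability of `final` is acceptance by `N`

  instanceOf : ℕ → Instance
  instanceOf n = record { system = system ; lifespan = 1 ; p₁ = zero ; p₂ = suc zero ; t₁ = chain n }

  steps⇒reachable : ∀ n {y y′} → Star _⟰_ (cfg start′ (chain n) 0 0 0 , λ _ → 0) y → Star _⟱_ y y′ →
                    state (proj₁ y′) ≡ encode final → Reachable (instanceOf n)
  steps⇒reachable n {y′ = ⟪ _ , t , ν ⟫ , _} ups downs refl = t , ν , aged⇒run system 1 refl ups downs

  answers⇒reachable : ∀ n → Answers N n true → Reachable (instanceOf n)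
  answers⇒reachable n answers =
    let _ , _ , ups , downs , at-final = finishes n answers in steps⇒reachable n ups downs at-final

  reachable⇒answers : ∀ n → Reachable (instanceOf n) → Answers N n true
  reachable⇒answers n (t , ν , k , run , first , last , restricted)
    with age , steps ← run⇒aged system 1 run restricted
    rewrite first | last =
    proj₂ (sound steps refl (sym (cong +_ (units-chain (λ _ → 1) n))) (λ ()) start′ refl)
      {n} {n} refl (sym (ℤ.+-identityʳ (+ n)))

-- A register machine computing codes of instances

infixr 5 _⨾_
data Program (R : ℕ) : Set where
  inc  : Fin R → Program R
  _⨾_  : Program R → Program R → Program R
  -- loop r p: while r is positive, decrement r and execute p
  loop : Fin R → Program R → Program R

module _ {R : ℕ} where

  data Executes : Program R → Vec ℕ R → Vec ℕ R → Set where
    inc   : ∀ {r v} → Executes (inc r) v (v [ r ]≔ suc (lookup v r))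
    _⨾_   : ∀ {p q u v w} → Executes p u v → Executes q v w → Executes (p ⨾ q) u w
    done  : ∀ {r p v} → lookup v r ≡ 0 → Executes (loop r p) v v
    again : ∀ {r p m u v w} → lookup u r ≡ suc m →
            Executes p (u [ r ]≔ m) v → Executes (loop r p) v w → Executes (loop r p) u w

  size : Program R → ℕ
  size (inc r)    = 1
  size (p ⨾ q)    = size p + size q
  size (loop r p) = suc (size p)

  entry : ∀ p → Fin (size p)
  entry (inc r)    = zero
  entry (p ⨾ q)    = entry p ↑ˡ size q
  entry (loop r p) = zero

  -- `at` says at which labels the instructions of `p` are placed, and `exit` which label follows
  -- them. The body of a loop exits to the test of that loop.
  compile : ∀ {n} p → (Fin (size p) → Fin n) → Fin n → Fin (size p) → Instruction n R
  compile (inc r)    at exit _       = inc r exit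
  compile (p ⨾ q)    at exit i       =
    [ compile p (at ∘ (_↑ˡ size q)) (at (size p ↑ʳ entry q))
    , compile q (at ∘ (size p ↑ʳ_)) exit ]′ (splitAt (size p) i)
  compile (loop r p) at exit zero    = dec r (at (suc (entry p))) exit
  compile (loop r p) at exit (suc i) = compile p (at ∘ suc) (at zero) i

module _ (M : Machine) where
  open Machine M

  executes⇒run : ∀ {p v w} → Executes p v w → (at : Fin (size p) → Fin labels) (exit : Fin labels) →
    (∀ i → lookup program (at i) ≡ compile p at exit i) →
    Star (_⟶_ M) (at (entry p) , v) (exit , w)
  executes⇒run inc at exit code = inc (code zero) ◅ ε
  executes⇒run (_⨾_ {p} {q} e e′) at exit code =
    executes⇒run e (at ∘ (_↑ˡ size q)) (at (size p ↑ʳ entry q))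
      (λ i → trans (code (i ↑ˡ size q)) (cong [ _ , _ ]′ (Fin.splitAt-↑ˡ (size p) i (size q)))) ◅◅
    executes⇒run e′ (at ∘ (size p ↑ʳ_)) exit
      (λ i → trans (code (size p ↑ʳ i)) (cong [ _ , _ ]′ (Fin.splitAt-↑ʳ (size p) (size q) i)))
  executes⇒run (done e) at exit code = jzero (code zero) e ◅ ε
  executes⇒run (again e body rest) at exit code =
    dec (code zero) e ◅ executes⇒run body (at ∘ suc) (at zero) (code ∘ suc) ◅◅
    executes⇒run rest at exit code

  -- Determinism and uniqueness of answers

  ⟶-deterministic : ∀ {x y z} → _⟶_ M x y → _⟶_ M x z → y ≡ z
  ⟶-deterministic (inc e) (inc e′) with refl ← trans (sym e) e′ = refl
  ⟶-deterministic (dec e p) (dec e′ p′)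
    with refl ← trans (sym e) e′ with refl ← trans (sym p) p′ = refl
  ⟶-deterministic (jzero e z) (jzero e′ z′) with refl ← trans (sym e) e′ = refl
  ⟶-deterministic (inc e) (dec e′ _) with () ← trans (sym e) e′
  ⟶-deterministic (inc e) (jzero e′ _) with () ← trans (sym e) e′
  ⟶-deterministic (dec e _) (inc e′) with () ← trans (sym e) e′
  ⟶-deterministic (jzero e _) (inc e′) with () ← trans (sym e) e′
  ⟶-deterministic (dec e p) (jzero e′ z)
    with refl ← trans (sym e) e′ with () ← trans (sym p) z
  ⟶-deterministic (jzero e z) (dec e′ p)
    with refl ← trans (sym e) e′ with () ← trans (sym p) z

  halt-stuck : ∀ {l v b y} → lookup program l ≡ halt b → _⟶_ M (l , v) y → ⊥
  halt-stuck h (inc e) with () ← trans (sym h) e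
  halt-stuck h (dec e _) with () ← trans (sym h) e
  halt-stuck h (jzero e _) with () ← trans (sym h) e

  answers-unique : ∀ {n b b′} → Answers M n b → Answers M n b′ → b ≡ b′
  answers-unique (_ , _ , p , h) (_ , _ , p′ , h′) = unique p h p′ h′
    where
    unique : ∀ {x l v l′ v′ b b′} → Star (_⟶_ M) x (l , v) → lookup program l ≡ halt b →
             Star (_⟶_ M) x (l′ , v′) → lookup program l′ ≡ halt b′ → b ≡ b′
    unique ε h ε h′ with refl ← trans (sym h) h′ = refl
    unique ε h (s ◅ _) h′ = ⊥-elim (halt-stuck h s)
    unique (s ◅ _) h ε h′ = ⊥-elim (halt-stuck h′ s)
    unique (s ◅ p) h (s′ ◅ p′) h′ with refl ← ⟶-deterministic s s′ = unique p h p′ h′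

-- The code of an instance and the program that computes it

towerCode : ℕ → ℕ
-- The leaf `x` is symbol number 3, after `a`, `c` and `f`, and its empty vector of children has
-- code 0.
towerCode zero    = ⟨ 3 , 0 ⟩
towerCode (suc n) = ⟨ 0 , ⟨ towerCode n , 0 ⟩ ⟩

-- From the outside: system, lifespan 1, states 0 and 1, and the chain with root symbol 1. The
-- diagonal lies in the two uses of `n`, as code of the system and as length of the chain.
instanceCode : ℕ → ℕ
instanceCode n = ⟨ n , ⟨ 1 , ⟨ 0 , ⟨ 1 , ⟨ 1 , ⟨ towerCode n , 0 ⟩ ⟩ ⟩ ⟩ ⟩ ⟩

module _ {o : ℕ} where
  pattern r₀ = zero
  pattern r₁ = suc r₀
  pattern r₂ = suc r₁
  pattern r₃ = suc r₂
  pattern r₄ = suc r₃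

  -- The value is kept in `r₄`; `r₃`, and in `power` also `r₀`, are scratch and end up empty. Since
  -- ⟨ 0 , e ⟩ is 2e + 1 and raising the first component by one doubles a pair, `pair₀` and `pair₁`
  -- form pairs with first component 0 and 1, while `power` computes ⟨ e , 0 ⟩, a power of 2.
  double pair₀ pair₁ power encode-instance : Program (5 + o)
  double = loop r₄ (inc r₃ ⨾ inc r₃) ⨾ loop r₃ (inc r₄)
  pair₀  = double ⨾ inc r₄
  pair₁  = pair₀ ⨾ double
  power  = inc r₃ ⨾ loop r₄ (loop r₃ (inc r₀ ⨾ inc r₀) ⨾ loop r₀ (inc r₃)) ⨾ loop r₃ (inc r₄)
  encode-instance =
    loop r₀ (inc r₁ ⨾ inc r₂) ⨾
    -- Eight is ⟨ 3 , 0 ⟩, the code of the leaf `x`.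
    inc r₄ ⨾ inc r₄ ⨾ inc r₄ ⨾ inc r₄ ⨾ inc r₄ ⨾ inc r₄ ⨾ inc r₄ ⨾ inc r₄ ⨾
    -- The code is built from the inside: `n` symbols `a`, the root `c`, the states 1 and 0, the
    -- lifespan 1. The last `pair₀` followed by `n` doublings puts `n` in front as code of the
    -- system.
    loop r₁ (power ⨾ pair₀) ⨾ power ⨾ pair₁ ⨾ pair₁ ⨾ pair₀ ⨾ pair₁ ⨾ pair₀ ⨾ loop r₂ double

  module _ {w : Vec ℕ o} where

    regs : ℕ → ℕ → ℕ → ℕ → ℕ → Vec ℕ (5 + o)
    regs a b c d e = a ∷ b ∷ c ∷ d ∷ e ∷ w

    reach : ∀ {p u a b c d e a′ b′ c′ d′ e′} → a ≡ a′ → b ≡ b′ → c ≡ c′ → d ≡ d′ → e ≡ e′ →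
            Executes p u (regs a b c d e) → Executes p u (regs a′ b′ c′ d′ e′)
    reach refl refl refl refl refl x = x

    add₃₄ : ∀ {a b c} d {e} → Executes (loop r₃ (inc r₄)) (regs a b c d e) (regs a b c 0 (d + e))
    add₃₄ zero    = done refl
    add₃₄ (suc d) = again refl inc (reach refl refl refl refl (ℕ.+-suc d _) (add₃₄ d))

    add₀₃ : ∀ a {b c d e} → Executes (loop r₀ (inc r₃)) (regs a b c d e) (regs 0 b c (a + d) e)
    add₀₃ zero    = done refl
    add₀₃ (suc a) = again refl inc (reach refl refl refl (ℕ.+-suc a _) refl (add₀₃ a))

    twice : ∀ m n → 2 * m + suc (suc n) ≡ 2 * suc m + n
    twice = ℕ-Solver.solve-∀

    twice₄₃ : ∀ {a b c d} e → Executes (loop r₄ (inc r₃ ⨾ inc r₃)) (regs a b c d e) (regs a b c (2 * e + d) 0)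
    twice₄₃ zero    = done refl
    twice₄₃ (suc e) = again refl (inc ⨾ inc) (reach refl refl refl (twice e _) refl (twice₄₃ e))

    twice₃₀ : ∀ {a b c} d {e} → Executes (loop r₃ (inc r₀ ⨾ inc r₀)) (regs a b c d e) (regs (2 * d + a) b c 0 e)
    twice₃₀ zero    = done refl
    twice₃₀ (suc d) = again refl (inc ⨾ inc) (reach (twice d _) refl refl refl refl (twice₃₀ d))

    executes-double : ∀ {a b c} e → Executes double (regs a b c 0 e) (regs a b c 0 (2 * e))
    executes-double e = twice₄₃ e ⨾ reach refl refl refl refl (simplify e) (add₃₄ (2 * e + 0))
      where
      simplify : ∀ e → 2 * e + 0 + 0 ≡ 2 * e
      simplify = ℕ-Solver.solve-∀

    executes-pair₀ : ∀ {a b c} e → Executes pair₀ (regs a b c 0 e) (regs a b c 0 ⟨ 0 , e ⟩)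
    executes-pair₀ e = executes-double e ⨾ reach refl refl refl refl (sym (ℕ.*-identityˡ (suc (2 * e)))) inc

    executes-pair₁ : ∀ {a b c} e → Executes pair₁ (regs a b c 0 e) (regs a b c 0 ⟨ 1 , e ⟩)
    executes-pair₁ e = executes-pair₀ e ⨾ reach refl refl refl refl (sym (ℕ.*-assoc 2 1 (suc (2 * e))))
      (executes-double ⟨ 0 , e ⟩)

    executes-power : ∀ {b c} e → Executes power (regs 0 b c 0 e) (regs 0 b c 0 ⟨ e , 0 ⟩)
    executes-power e = inc ⨾ iterate e ⨾ reach refl refl refl refl (ℕ.+-identityʳ (2 ^ e * 1)) (add₃₄ (2 ^ e * 1))
      where
      rearrange : ∀ p d → p * (2 * d + 0 + 0) ≡ 2 * p * d
      rearrange = ℕ-Solver.solve-∀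
      iterate : ∀ {b c d} e → Executes (loop r₄ (loop r₃ (inc r₀ ⨾ inc r₀) ⨾ loop r₀ (inc r₃)))
                  (regs 0 b c d e) (regs 0 b c (2 ^ e * d) 0)
      iterate zero    = reach refl refl refl (sym (ℕ.*-identityˡ _)) refl (done refl)
      iterate {d = d} (suc e) = again refl (twice₃₀ d ⨾ add₀₃ (2 * d + 0))
        (reach refl refl refl (rearrange (2 ^ e) d) refl (iterate e))

    copy : ∀ a {b c e} → Executes (loop r₀ (inc r₁ ⨾ inc r₂)) (regs a b c 0 e) (regs 0 (a + b) (a + c) 0 e)
    copy zero    = done refl
    copy (suc a) = again refl (inc ⨾ inc)
      (reach refl (ℕ.+-suc a _) (ℕ.+-suc a _) refl refl (copy a))

    build-tower : ∀ b k {c} → Executes (loop r₁ (power ⨾ pair₀))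
      (regs 0 b c 0 (towerCode k)) (regs 0 0 c 0 (towerCode (b + k)))
    build-tower zero    k = done refl
    build-tower (suc b) k = again refl (executes-power (towerCode k) ⨾ executes-pair₀ ⟨ towerCode k , 0 ⟩)
      (reach refl refl refl refl (cong towerCode (ℕ.+-suc b k)) (build-tower b (suc k)))

    shift : ∀ c {e} → Executes (loop r₂ double) (regs 0 0 c 0 e) (regs 0 0 0 0 (2 ^ c * e))
    shift zero    = reach refl refl refl refl (sym (ℕ.*-identityˡ _)) (done refl)
    shift (suc c) {e} = again refl (executes-double e)
      (reach refl refl refl refl (rearrange (2 ^ c) e) (shift c))
      where
      rearrange : ∀ p e → p * (2 * e) ≡ 2 * p * e
      rearrange = ℕ-Solver.solve-∀

    executes-encode : ∀ n → Executes encode-instance (regs n 0 0 0 0) (regs 0 0 0 0 (instanceCode n))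
    executes-encode n =
      reach refl (ℕ.+-identityʳ n) (ℕ.+-identityʳ n) refl refl (copy n) ⨾
      inc ⨾ inc ⨾ inc ⨾ inc ⨾ inc ⨾ inc ⨾ inc ⨾ inc ⨾
      reach refl refl refl refl (cong towerCode (ℕ.+-identityʳ n)) (build-tower n 0) ⨾
      executes-power _ ⨾ executes-pair₁ _ ⨾ executes-pair₁ _ ⨾ executes-pair₀ _ ⨾
      executes-pair₁ _ ⨾ executes-pair₀ _ ⨾
      reach refl refl refl refl (cong (2 ^ n *_) (ℕ.*-identityˡ _)) (shift n)

-- Execute p, then run M in the registers from number 4 on, and negate its answer.
module Composition (M : Machine) (p : Program (5 + Machine.others M)) where
  open Machine M

  relocate : Instruction labels registers → Instruction (size p + labels) (4 + registers)
  relocate (inc r l)    = inc (4 ↑ʳ r) (size p ↑ʳ l)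
  relocate (dec r l l′) = dec (4 ↑ʳ r) (size p ↑ʳ l) (size p ↑ʳ l′)
  relocate (halt b)     = halt (Bool.not b)

  preliminary : Fin (size p) → Instruction (size p + labels) (4 + registers)
  preliminary = compile p (_↑ˡ labels) (size p ↑ʳ start)

  instruction : Fin (size p + labels) → Instruction (size p + labels) (4 + registers)
  instruction l = [ preliminary , relocate ∘ lookup program ]′ (splitAt (size p) l)

  composition : Machine
  composition = record
    { labels = size p + labels ; others = 3 + registers
    ; start = entry p ↑ˡ labels ; program = tabulate instruction }

  code-left : ∀ i → lookup (Machine.program composition) (i ↑ˡ labels) ≡ preliminary i
  code-left i = trans (Vec.lookup∘tabulate instruction (i ↑ˡ labels))
    (cong [ preliminary , relocate ∘ lookup program ]′ (Fin.splitAt-↑ˡ (size p) i labels))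

  code-right : ∀ {l ins} → lookup program l ≡ ins →
               lookup (Machine.program composition) (size p ↑ʳ l) ≡ relocate ins
  code-right {l} refl = trans (Vec.lookup∘tabulate instruction (size p ↑ʳ l))
    (cong [ preliminary , relocate ∘ lookup program ]′ (Fin.splitAt-↑ʳ (size p) labels l))

  relocated : MachineState M → MachineState composition
  relocated (l , v) = size p ↑ʳ l , 0 ∷ 0 ∷ 0 ∷ 0 ∷ v

  step-relocated : ∀ {x y} → _⟶_ M x y → _⟶_ composition (relocated x) (relocated y)
  step-relocated (inc e)     = inc (code-right e)
  step-relocated (dec e p)   = dec (code-right e) p
  step-relocated (jzero e z) = jzero (code-right e) z

  run-relocated : ∀ {x y} → Star (_⟶_ M) x y → Star (_⟶_ composition) (relocated x) (relocated y)
  run-relocated ε       = ε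
  run-relocated (s ◅ q) = step-relocated s ◅ run-relocated q

  composition-answers : ∀ {n m b} →
    Executes p (n ∷ replicate (3 + registers) 0) (0 ∷ 0 ∷ 0 ∷ 0 ∷ m ∷ replicate others 0) →
    Answers M m b → Answers composition n (Bool.not b)
  composition-answers e (l , v , q , h) = _ , _ ,
    executes⇒run composition e (_↑ˡ labels) (size p ↑ʳ start) code-left ◅◅ run-relocated q ,
    code-right h

-- Diagonalisation

open Injection using (to)

tower-code : ∀ {R} n → to (Tree↣ℕ Fin↣ℕ {RankedAlphabet.rank (alphabet (suc R))}) (tower n) ≡ towerCode n
tower-code zero    = refl
tower-code (suc n) = cong (λ k → ⟨ 0 , ⟨ k , 0 ⟩ ⟩) (tower-code n)

chain-code : ∀ {R} n → to (Tree↣ℕ Fin↣ℕ {RankedAlphabet.rank (alphabet (suc R))}) (chain n) ≡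
                       ⟨ 1 , ⟨ towerCode n , 0 ⟩ ⟩
chain-code n = cong (λ k → ⟨ 1 , ⟨ k , 0 ⟩ ⟩) (tower-code n)

-- The codes are huge numerals, which must not be evaluated: therefore the
-- instance, its system and the code g of the latter are variables here.
instance-code : ∀ {I g} G p₁ p₂ t →
  record { system = G ; lifespan = 1 ; p₁ = p₁ ; p₂ = p₂ ; t₁ = t } ≡ I →
  to RbGTRS↣ℕ G ≡ g → Fin.toℕ p₁ ≡ 0 → Fin.toℕ p₂ ≡ 1 →
  to (Tree↣ℕ Fin↣ℕ) t ≡ ⟨ 1 , ⟨ towerCode g , 0 ⟩ ⟩ →
  to Instance↣ℕ I ≡ instanceCode g
instance-code G p₁ p₂ t refl e e₁ e₂ e₃ =
  cong₂ (λ g k → ⟨ g , ⟨ 1 , k ⟩ ⟩) e (cong₂ ⟨_,_⟩ e₁ (cong₂ ⟨_,_⟩ e₂ e₃))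

-- `N` on `g` negates what `M` says about `x`, yet accepts exactly if `P x`. If `M` says yes, `N`
-- gives both answers, against determinism; if `M` says no, `N` accepts and `P x` holds after all.
not-decided-by : ∀ {A : Set} {encoding : A ↣ ℕ} {P : A → Set} M N {x g n} → to encoding x ≡ n →
  (∀ {b} → Answers M n b → Answers N g (Bool.not b)) →
  (Answers N g true → P x) → (P x → Answers N g true) →
  ¬ Decides M encoding P
not-decided-by M N {x} refl negates answers⇒P P⇒answers decides with decides x
... | true  , a , ofʸ Px  = case answers-unique N (negates a) (P⇒answers Px) of λ ()
... | false , a , ofⁿ ¬Px = ¬Px (answers⇒P (negates a))

not-decided : ∀ M N g → to RbGTRS↣ℕ (Reduction.system N) ≡ g →
              (∀ {b} → Answers M (instanceCode g) b → Answers N g (Bool.not b)) →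
              ¬ Decides M Instance↣ℕ Reachable
not-decided M N g e negates = not-decided-by {encoding = Instance↣ℕ} {Reachable} M N
  {Reduction.instanceOf N g} {g} {instanceCode g}
  (instance-code {Reduction.instanceOf N g} (Reduction.system N) zero (suc zero) (chain g)
    refl e refl refl (chain-code g))
  negates (Reduction.answers⇒reachable N g) (Reduction.reachable⇒answers N g)

-- The machine N reads the code of its own reduct from the initial tree.
theorem6 : ¬ (AlgorithmicallyDecidable Instance↣ℕ Reachable)
theorem6 (M , decides) = not-decided M N (to RbGTRS↣ℕ (Reduction.system N)) refl
  (Composition.composition-answers M encode-instance (executes-encode _)) decides
  where
  N : Machine
  N = Composition.composition M encode-instance
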